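{- For every integer $n\ge 9$, $$\max\{f(P(n),M): M\in\mathcal{M}_1(P(n))\}=\left\lceil \frac{n}{4}\right\rceil .$$
   Context: For $n\ge 3$, $P(n)=P(n,2)$ is the simple graph with vertex set $\{u_i,v_i:0\le i\le n-1\}$ and edge set $\{u_iu_{i+2},\,u_iv_i,\,v_iv_{i+1}:0\le i\le n-1\}$, subscripts modulo $n$. The edges $u_iv_i$ are called spokes. For a perfect matching $M$ of a graph $G$, a forcing set of $M$ is a subset $S\subseteq M$ contained in no perfect matching of $G$ other than $M$; the forcing number $f(G,M)$ is the minimum cardinality of a forcing set of $M$. $\mathcal{M}_1(P(n))$ is the set of perfect matchings $M$ of $P(n)$ such that either (i) $M$ contains at least one spoke, and for any two (cyclically) consecutive spokes $u_iv_i,u_jv_j$ of $M$ the number of spokes $u_kv_k$ of $P(n)$ strictly between them, $j-i-1$ (with $j$ taken as the representative in $(i,i+n]$), is $\equiv 0\pmod 4$ (if $M$ has exactly one spoke $u_iv_i$, it is regarded as two consecutive spokes with $j=i+n$, so the number is $n-1$); or (ii) $M$ contains no spoke, $4\mid n$, and for some $i$, $M=\bigcup_{k=0}^{n/4-1}\{u_{i+4k}u_{i+4k+2},\,u_{i+4k+1}u_{i+4k+3},\,v_{i+4k}v_{i+4k+1},\,v_{i+4k+2}v_{i+4k+3}\}$. -}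

module Defs where

open import Data.Nat
  using (ℕ; _+_; _*_; _∸_; _≤_; _<_; _≥_; _/_; _%_; NonZero; z<s; s<s)
open import Data.Nat.Properties
  using (+-assoc; +-cancelˡ-≡; ≤-trans; <⇒≱)
open import Data.Nat.DivMod
  using (_mod_; m≡m%n+[m/n]*n; %-distribˡ-+; m%n%n≡m%n; m%n<n)
open import Data.Nat.Divisibility using (_∣_; divides; ∣⇒≤)
open import Data.Fin using (Fin; toℕ; combine; remQuot)
open import Data.Fin.Patterns using (0F; 1F; 2F)
open import Data.Fin.Properties
  using (toℕ-fromℕ<; combine-remQuot)
open import Data.Fin.Subset using (Subset; _∈_; _∉_; _⊆_; _∪_; ⁅_⁆; ⋃; ∣_∣)
open import Data.List using (map; upTo)
open import Data.Product using (_×_; _,_; proj₁; proj₂; ∃-syntax; ∃!; swap)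
open import Data.Sum using (_⊎_; inj₁; inj₂)
open import Data.Empty using (⊥; ⊥-elim)
open import Function using (_∘_)
open import Relation.Binary.PropositionalEquality
  using (_≡_; _≢_; refl; sym; trans; cong; module ≡-Reasoning)

IsMinimum : (ℕ → Set) → ℕ → Set
IsMinimum A k = A k × (∀ m → A m → k ≤ m)

IsMaximum : (ℕ → Set) → ℕ → Set
IsMaximum A k = A k × (∀ m → A m → m ≤ k)

⌈_/4⌉ : ℕ → ℕ
⌈ n /4⌉ = (n + 3) / 4

-- Finitely many edges, listed by Fin size so that sets of edges are elements
-- of Subset size.  The orientation given by ends is irrelevant.  Loops and
-- parallel edges are excluded by IsSimple, not by the record.
record Graph : Set₁ where
  field
    Vertex : Set
    size   : ℕ
    ends   : Fin size → Vertex × Vertex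

  Edge : Set
  Edge = Fin size

  EdgeSet : Set
  EdgeSet = Subset size

module _ (G : Graph) where
  open Graph G

  IsSimple : Set
  IsSimple =
      (∀ e → proj₁ (ends e) ≢ proj₂ (ends e))
    × (∀ e f → ends e ≡ ends f ⊎ ends e ≡ swap (ends f) → e ≡ f)

  Incident : Edge → Vertex → Set
  Incident e x = x ≡ proj₁ (ends e) ⊎ x ≡ proj₂ (ends e)

  IsPerfectMatching : EdgeSet → Set
  IsPerfectMatching M = ∀ x → ∃! _≡_ λ e → e ∈ M × Incident e x

  IsForcingSet : EdgeSet → EdgeSet → Set
  IsForcingSet M S =
    S ⊆ M × (∀ M′ → IsPerfectMatching M′ → S ⊆ M′ → M′ ≡ M)

  -- IsForcingNumber M k says f(G,M) = k.  Since M is a forcing set of itself,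
  -- the minimum is over a nonempty set.
  IsForcingNumber : EdgeSet → ℕ → Set
  IsForcingNumber M = IsMinimum λ k → ∃[ S ] IsForcingSet M S × ∣ S ∣ ≡ k

module _ (n : ℕ) .{{_ : NonZero n}} where

  data PVertex : Set where
    u v : Fin n → PVertex

  infixl 6 _⊕_
  _⊕_ : Fin n → ℕ → Fin n
  i ⊕ d = (toℕ i + d) mod n

  -- The 3n edges are labelled by pairs in Fin 3 × Fin n, coded in Fin (3 * n).
  labelEnds : Fin 3 × Fin n → PVertex × PVertex
  labelEnds (0F , i) = u i , u (i ⊕ 2)
  labelEnds (1F , i) = u i , v i
  labelEnds (2F , i) = v i , v (i ⊕ 1)

  -- The generalized Petersen graph P(n,2).  For n = 4 the labels of u₀u₂ and
  -- u₂u₄ = u₂u₀ differ, so this is the intended simple graph only for other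
  -- n ≥ 3; P-simple below covers n ≥ 5.
  P : Graph
  P = record
    { Vertex = PVertex
    ; size   = 3 * n
    ; ends   = labelEnds ∘ remQuot n
    }

  open Graph P using (Edge; EdgeSet)

  -- u_k u_{k+2}, u_k v_k and v_k v_{k+1}, with subscripts modulo n.
  uu spoke vv : ℕ → Edge
  uu    k = combine {3} 0F (k mod n)
  spoke k = combine {3} 1F (k mod n)
  vv    k = combine {3} 2F (k mod n)

  -- j ranges over (i, i+n]; j = i + n occurs exactly when M has one spoke.
  ConsecutiveSpokes : EdgeSet → ℕ → ℕ → Set
  ConsecutiveSpokes M i j =
      (i < j × j ≤ i + n)
    × (spoke i ∈ M × spoke j ∈ M)
    × (∀ k → i < k → k < j → spoke k ∉ M)

  SpokedType : EdgeSet → Set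
  SpokedType M =
      (∃[ k ] spoke k ∈ M)
    × (∀ i j → ConsecutiveSpokes M i j → 4 ∣ j ∸ i ∸ 1)

  spokelessMatching : ℕ → EdgeSet
  spokelessMatching i = ⋃ (map block (upTo (n / 4)))
    where
    block : ℕ → EdgeSet
    block k = ⁅ uu (i + 4 * k) ⁆ ∪ ⁅ uu (i + 4 * k + 1) ⁆
            ∪ ⁅ vv (i + 4 * k) ⁆ ∪ ⁅ vv (i + 4 * k + 2) ⁆

  SpokelessType : EdgeSet → Set
  SpokelessType M =
    (∀ k → spoke k ∉ M) × 4 ∣ n × (∃[ i ] M ≡ spokelessMatching i)

  𝓜₁ : EdgeSet → Set
  𝓜₁ M = IsPerfectMatching P M × (SpokedType M ⊎ SpokelessType M)

  private
    toℕ-⊕ : ∀ i d → toℕ (i ⊕ d) ≡ (toℕ i + d) % n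
    toℕ-⊕ i d = toℕ-fromℕ< (m%n<n (toℕ i + d) n)

    ⊕-≢ : ∀ d .{{_ : NonZero d}} → d < n → (i : Fin n) → (toℕ i + d) % n ≢ toℕ i
    ⊕-≢ d d<n i eq = <⇒≱ d<n (∣⇒≤ (divides q (+-cancelˡ-≡ (toℕ i) d (q * n) lem)))
      where
      q : ℕ
      q = (toℕ i + d) / n
      lem : toℕ i + d ≡ toℕ i + q * n
      lem = trans (m≡m%n+[m/n]*n (toℕ i + d) n) (cong (_+ q * n) eq)

    ⊕-⊕ : ∀ i a b → toℕ (i ⊕ a ⊕ b) ≡ (toℕ i + (a + b)) % n
    ⊕-⊕ i a b = begin
      toℕ (i ⊕ a ⊕ b)                   ≡⟨ toℕ-⊕ (i ⊕ a) b ⟩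
      (toℕ (i ⊕ a) + b) % n             ≡⟨ cong (λ x → (x + b) % n) (toℕ-⊕ i a) ⟩
      ((toℕ i + a) % n + b) % n         ≡⟨ %-distribˡ-+ ((toℕ i + a) % n) b n ⟩
      ((toℕ i + a) % n % n + b % n) % n ≡⟨ cong (λ x → (x + b % n) % n) (m%n%n≡m%n (toℕ i + a) n) ⟩
      ((toℕ i + a) % n + b % n) % n     ≡⟨ %-distribˡ-+ (toℕ i + a) b n ⟨
      (toℕ i + a + b) % n               ≡⟨ cong (_% n) (+-assoc (toℕ i) a b) ⟩
      (toℕ i + (a + b)) % n             ∎
      where open ≡-Reasoning

    u-injective : ∀ {i j} → u i ≡ u j → i ≡ j
    u-injective refl = refl

    v-injective : ∀ {i j} → v i ≡ v j → i ≡ j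
    v-injective refl = refl

    no-swap : ∀ d .{{_ : NonZero (d + d)}} → d + d < n →
              ∀ {i j} → i ≡ j ⊕ d → i ⊕ d ≡ j → ⊥
    no-swap d 2d<n {j = j} refl eq =
      ⊕-≢ (d + d) 2d<n j (trans (sym (⊕-⊕ j d d)) (cong toℕ eq))

  P-simple : n ≥ 5 → IsSimple P
  P-simple n≥5 = (λ e → loopless (remQuot n e)) , λ e f eq →
    trans (sym (combine-remQuot n e))
      (trans (cong (λ (k , i) → combine {3} k i) (unique (remQuot n e) (remQuot n f) eq))
             (combine-remQuot n f))
    where
    1<n : 1 < n
    1<n = ≤-trans (s<s z<s) n≥5
    2<n : 2 < n
    2<n = ≤-trans (s<s (s<s z<s)) n≥5

    loopless : ∀ l → proj₁ (labelEnds l) ≢ proj₂ (labelEnds l)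
    loopless (0F , i) eq = ⊕-≢ 2 2<n i (trans (sym (toℕ-⊕ i 2)) (cong toℕ (sym (u-injective eq))))
    loopless (1F , i) ()
    loopless (2F , i) eq = ⊕-≢ 1 1<n i (trans (sym (toℕ-⊕ i 1)) (cong toℕ (sym (v-injective eq))))

    unique : ∀ l m → labelEnds l ≡ labelEnds m ⊎ labelEnds l ≡ swap (labelEnds m) → l ≡ m
    unique (0F , i) (0F , j) (inj₁ eq) = cong (0F ,_) (u-injective (cong proj₁ eq))
    unique (0F , i) (0F , j) (inj₂ eq) =
      ⊥-elim (no-swap 2 n≥5 (u-injective (cong proj₁ eq)) (u-injective (cong proj₂ eq)))
    unique (0F , i) (1F , j) (inj₁ ())
    unique (0F , i) (1F , j) (inj₂ ())
    unique (0F , i) (2F , j) (inj₁ ())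
    unique (0F , i) (2F , j) (inj₂ ())
    unique (1F , i) (0F , j) (inj₁ ())
    unique (1F , i) (0F , j) (inj₂ ())
    unique (1F , i) (1F , j) (inj₁ eq) = cong (1F ,_) (u-injective (cong proj₁ eq))
    unique (1F , i) (1F , j) (inj₂ ())
    unique (1F , i) (2F , j) (inj₁ ())
    unique (1F , i) (2F , j) (inj₂ ())
    unique (2F , i) (0F , j) (inj₁ ())
    unique (2F , i) (0F , j) (inj₂ ())
    unique (2F , i) (1F , j) (inj₁ ())
    unique (2F , i) (1F , j) (inj₂ ())
    unique (2F , i) (2F , j) (inj₁ eq) = cong (2F ,_) (v-injective (cong proj₁ eq))
    unique (2F , i) (2F , j) (inj₂ eq) =
      ⊥-elim (no-swap 1 2<n (v-injective (cong proj₁ eq)) (v-injective (cong proj₂ eq)))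

module Submission where

-- A perfect matching of P(n,2) that has a cut, i.e. a place where no edge joins
-- earlier positions to later ones, is a cyclic tiling of the positions by
-- single spokes and by 4-tiles {u_b u_{b+2}, u_{b+1} u_{b+3}, v_b v_{b+1},
-- v_{b+2} v_{b+3}}; the matchings in 𝓜₁ are of this kind.
--
-- Upper bound: start at a spoke that is followed by a 4-tile (or at any spoke if
-- all edges of M are spokes) and mark one edge of M for every fourth position p:
-- the spoke at p, or, if p = b + r lies in the 4-tile at b, the edge
-- u_{b+1} u_{b+3}, v_{b+2} v_{b+3}, v_b v_{b+1}, u_b u_{b+2} for r = 0, 1, 2, 3.
-- A matching containing the marks has the same initial cut, and at the first
-- place where its tiling departs from that of M it either misses a mark or stays
-- out of step up to the final cut, which is absurd.  Without spokes one edge per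
-- 4-tile suffices once the first three are chosen to force a cut.
--
-- Lower bound: for the matching of all spokes, any four cyclically consecutive
-- spokes can be exchanged for a 4-tile, so a forcing set meets each of these n
-- windows, and every spoke lies in only four of them.

open import Defs
open import Data.Bool using (Bool; true; false)
open import Data.Empty using (⊥; ⊥-elim)
open import Data.Fin using (Fin; zero; suc; toℕ; combine; remQuot; _↑ˡ_; _↑ʳ_)
open import Data.Fin.Patterns using (0F; 1F; 2F; 3F)
open import Data.Fin.Properties
  using (toℕ-fromℕ<; toℕ-injective; toℕ<n; toℕ≤pred[n]; remQuot-combine; combine-remQuot)
open import Data.Fin.Subset using (Subset; _∈_; _∉_; _⊆_; _∪_; ⁅_⁆; ⋃; ∣_∣)
open import Data.Fin.Subset.Properties
  using (x∈p∪q⁺; x∈p∪q⁻; x∈⁅x⁆; x∈⁅y⁆⇒x≡y; ∣⊥∣≡0; ∣⁅x⁆∣≡1; ∉⊥; ∣p∣≤∣x∷p∣)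
open import Data.List using (List; []; _∷_; length; map; upTo)
open import Data.List.Relation.Unary.All as All using (All; []; _∷_)
open import Data.Nat
  using (ℕ; zero; suc; _+_; _*_; _∸_; _/_; _%_; _≤_; _<_; _≥_; NonZero; >-nonZero⁻¹; z≤n; s≤s; s≤s⁻¹)
open import Data.Nat.DivMod
open import Data.Nat.Divisibility using (_∣_; divides)
open import Data.Nat.Properties
open import Data.Nat.Solver using (module +-*-Solver)
open import Data.Product using (_×_; _,_; proj₁; proj₂; ∃-syntax; ∃!)
open import Data.Sum using (_⊎_; inj₁; inj₂)
open import Data.Vec using ([]; _∷_; lookup; tabulate)
open import Data.Vec.Properties
  using ([]=⇒lookup; lookup⇒[]=; lookup∘tabulate; tabulate∘lookup; tabulate-cong)
open import Function using (_∘_; case_of_; _⇔_; mk⇔)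
open import Function.Bundles using (module Equivalence)
open import Relation.Binary.PropositionalEquality
open import Relation.Nullary using (contradiction)

open import Algebra.Properties.CommutativeSemigroup +-commutativeSemigroup using (x∙yz≈y∙xz)
open Equivalence using (to; from)

-- Cuts and tilings

clash : ∀ {x : Bool} → x ≡ true → x ≡ false → ⊥
clash refl ()

-- The perfect matching condition at a cubic vertex, as data: matching on known values leaves only
-- the possible choices of edge.
data One : Bool → Bool → Bool → Set where
  one₁ : One true false false
  one₂ : One false true false
  one₃ : One false false true

-- A perfect matching of the infinite cover of the graphs P(n, 2): the label
-- (l , k) names u_k u_{k+2}, u_k v_k or v_k v_{k+1}, as in labelEnds.
record Config : Set where
  field has : Fin 3 → ℕ → Bool

  U : ℕ → Bool
  U = has 0F

  S : ℕ → Bool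
  S = has 1F

  V : ℕ → Bool
  V = has 2F

  field
    oneU : ∀ k → One (U k) (U (2 + k)) (S (2 + k))
    oneV : ∀ k → One (V k) (V (1 + k)) (S (1 + k))

open Config

Label : Set
Label = Fin 3 × ℕ

_∋_ : Config → Label → Set
N ∋ (l , k) = has N l k ≡ true

-- No edge joins positions ≤ 1 + a to positions ≥ 2 + a.
Cut : Config → ℕ → Set
Cut N a = V N (1 + a) ≡ false × U N a ≡ false × U N (1 + a) ≡ false

-- Here and in `QuadAt` the fields fix every label based in the tile, so two configurations with the
-- same tile agree on it.
record SpokeAt (N : Config) (p : ℕ) : Set where
  constructor mkSpoke
  field
    s₀ : S N p ≡ true
    u₀ : U N p ≡ false
    v₀ : V N p ≡ false

record QuadAt (N : Config) (p : ℕ) : Set where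
  constructor mkQuad
  field
    u₀ : U N p ≡ true
    u₁ : U N (1 + p) ≡ true
    u₂ : U N (2 + p) ≡ false
    u₃ : U N (3 + p) ≡ false
    s₀ : S N p ≡ false
    s₁ : S N (1 + p) ≡ false
    s₂ : S N (2 + p) ≡ false
    s₃ : S N (3 + p) ≡ false
    v₀ : V N p ≡ true
    v₁ : V N (1 + p) ≡ false
    v₂ : V N (2 + p) ≡ true
    v₃ : V N (3 + p) ≡ false

-- Position 2 is the first one after the cut. Without its spoke, both `u₂` and `v₂` must lead
-- forward; this excludes the spoke at 3 and forces `u₃`, and the values at 4 and 5 follow one by
-- one.
tile-local : ∀ {v₁ v₂ v₃ v₄ v₅ u₀ u₁ u₂ u₃ u₄ u₅ s₂ s₃ s₄ s₅} →
  v₁ ≡ false → u₀ ≡ false → u₁ ≡ false →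
  One v₁ v₂ s₂ → One u₀ u₂ s₂ → One v₂ v₃ s₃ → One u₁ u₃ s₃ →
  One u₂ u₄ s₄ → One v₃ v₄ s₄ → One u₃ u₅ s₅ → One v₄ v₅ s₅ →
  (s₂ ≡ true × u₂ ≡ false × v₂ ≡ false) ⊎
  (u₂ ≡ true × u₃ ≡ true × u₄ ≡ false × u₅ ≡ false ×
   s₂ ≡ false × s₃ ≡ false × s₄ ≡ false × s₅ ≡ false ×
   v₂ ≡ true × v₃ ≡ false × v₄ ≡ true × v₅ ≡ false)
tile-local refl refl refl one₃ one₃ _ _ _ _ _ _ = inj₁ (refl , refl , refl)
tile-local refl refl refl one₂ one₂ one₁ one₂ one₁ one₂ one₁ one₁ =
  inj₂ (refl , refl , refl , refl , refl , refl , refl , refl , refl , refl , refl , refl)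

tile : ∀ N a → Cut N a →
  (SpokeAt N (2 + a) × Cut N (1 + a)) ⊎ (QuadAt N (2 + a) × Cut N (4 + a))
tile N a (v₁ , u₀ , u₁)
  with tile-local v₁ u₀ u₁ (oneV N (1 + a)) (oneU N a) (oneV N (2 + a)) (oneU N (1 + a))
         (oneU N (2 + a)) (oneV N (3 + a)) (oneU N (3 + a)) (oneV N (4 + a))
... | inj₁ (s₂ , u₂ , v₂) = inj₁ (mkSpoke s₂ u₂ v₂ , v₂ , u₁ , u₂)
... | inj₂ (u₂ , u₃ , u₄ , u₅ , s₂ , s₃ , s₄ , s₅ , v₂ , v₃ , v₄ , v₅) =
  inj₂ (mkQuad u₂ u₃ u₄ u₅ s₂ s₃ s₄ s₅ v₂ v₃ v₄ v₅ , v₅ , u₄ , u₅)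

data Tiling (M : Config) (e : ℕ) : ℕ → Set where
  done  : Tiling M e e
  tile₁ : ∀ {a} → SpokeAt M (2 + a) → Tiling M e (1 + a) → Tiling M e a
  tile₄ : ∀ {a} → QuadAt M (2 + a) → Tiling M e (4 + a) → Tiling M e a

m+4+a : ∀ m a → m + (4 + a) ≡ 4 + (m + a)
m+4+a = solve 2 (λ m a → m :+ (con 4 :+ a) := con 4 :+ (m :+ a)) refl
  where open +-*-Solver

tiling : ∀ M m {e a} → m + a ≡ e → Cut M a → Cut M e → Tiling M e a
tiling M zero refl _ _ = done
tiling M (suc m) {a = a} refl c ce with tile M a c
... | inj₁ (sp , c′) = tile₁ sp (tiling M m (+-suc m a) c′ ce)
-- With fewer than four positions left, a 4-tile would have an edge across the final cut; the
-- distance decides which one.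
tiling M 1 refl c (hv , _ , _) | inj₂ (q , _) = ⊥-elim (clash (QuadAt.v₀ q) hv)
tiling M 2 refl c (_ , hu , _) | inj₂ (q , _) = ⊥-elim (clash (QuadAt.u₀ q) hu)
tiling M 3 refl c (hv , _ , _) | inj₂ (q , _) = ⊥-elim (clash (QuadAt.v₂ q) hv)
tiling M (suc (suc (suc (suc m)))) {a = a} refl c ce | inj₂ (q , c′) =
  tile₄ q (tiling M m (m+4+a m a) c′ ce)

-- Marks and forcing

-- One edge is marked for each term p of a progression with difference 4, in
-- the tile of M that covers p; the phase is the distance from the first
-- position of the tile to the next such p.
advance : Fin 4 → Fin 4
advance 0F = 3F
advance 1F = 0F
advance 2F = 1F
advance 3F = 2F

-- The edge varies with the phase so that misplaced tiles of `N` are caught. A spoke at the start of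
-- the tile contradicts the mark at once in phases 2 and 3, and otherwise ends in a contradiction or
-- an overrun. A 4-tile of `N` that began earlier and reaches past the term contradicts the mark.
quadMark : Fin 4 → ℕ → Label
quadMark 0F p = 0F , 1 + p
quadMark 1F p = 2F , 2 + p
quadMark 2F p = 2F , p
quadMark 3F p = 0F , p

-- Four consecutive positions contain exactly one term, so a 4-tile gets one mark and leaves the
-- phase as it was; a spoke gets one only in phase 0.
marks : ∀ {M e a} → Fin 4 → Tiling M e a → List Label
marks d done = []
marks {a = a} 0F (tile₁ _ t) = (1F , 2 + a) ∷ marks 3F t
marks d@(suc _) (tile₁ {a} _ t) = marks (advance d) t
marks d (tile₄ {a} _ t) = quadMark d (2 + a) ∷ marks d t

-- The left side is constant along the tiling, as each mark pays for the four positions up to the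
-- next term. At the end only the phase is left over, which is at most 3.
length-marks : ∀ {M e a} d (t : Tiling M e a) → 4 * length (marks d t) + toℕ d + a ≤ 3 + e
length-marks d done = +-monoˡ-≤ _ (toℕ≤pred[n] d)
length-marks {a = a} 0F (tile₁ _ t) =
  ≤-trans (≤-reflexive (eq (length (marks 3F t)) a)) (length-marks 3F t)
  where
  eq : ∀ L a → 4 * suc L + 0 + a ≡ 4 * L + 3 + (1 + a)
  eq = solve 2 (λ L a → con 4 :* (con 1 :+ L) :+ con 0 :+ a := con 4 :* L :+ con 3 :+ (con 1 :+ a)) refl
    where open +-*-Solver
length-marks (suc d) (tile₁ {a} _ t) =
  ≤-trans (≤-reflexive (trans (cong (λ k → 4 * L + k + a) (toℕ-advance d)) (eq L (toℕ d′) a)))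
          (length-marks d′ t)
  where
  d′ : Fin 4
  d′ = advance (suc d)
  L : ℕ
  L = length (marks d′ t)
  toℕ-advance : ∀ (d : Fin 3) → suc (toℕ d) ≡ suc (toℕ (advance (suc d)))
  toℕ-advance 0F = refl
  toℕ-advance 1F = refl
  toℕ-advance 2F = refl
  eq : ∀ L d a → 4 * L + suc d + a ≡ 4 * L + d + (1 + a)
  eq = solve 3 (λ L d a → con 4 :* L :+ (con 1 :+ d) :+ a := con 4 :* L :+ d :+ (con 1 :+ a)) refl
    where open +-*-Solver
length-marks d (tile₄ {a} _ t) =
  ≤-trans (≤-reflexive (eq (length (marks d t)) (toℕ d) a)) (length-marks d t)
  where
  eq : ∀ L d a → 4 * suc L + d + a ≡ 4 * L + d + (4 + a)
  eq = solve 3 (λ L d a → con 4 :* (con 1 :+ L) :+ d :+ a := con 4 :* L :+ d :+ (con 4 :+ a)) refl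
    where open +-*-Solver

marks-∈ : ∀ {M e a} d (t : Tiling M e a) → All (M ∋_) (marks d t)
marks-∈ d done = []
marks-∈ 0F (tile₁ sp t) = SpokeAt.s₀ sp ∷ marks-∈ 3F t
marks-∈ d@(suc _) (tile₁ sp t) = marks-∈ (advance d) t
marks-∈ 0F (tile₄ q t) = QuadAt.u₁ q ∷ marks-∈ 0F t
marks-∈ 1F (tile₄ q t) = QuadAt.v₂ q ∷ marks-∈ 1F t
marks-∈ 2F (tile₄ q t) = QuadAt.v₀ q ∷ marks-∈ 2F t
marks-∈ 3F (tile₄ q t) = QuadAt.u₀ q ∷ marks-∈ 3F t

Agree : Config → Config → ℕ → Set
Agree M N k = ∀ l → has M l k ≡ has N l k

module _ {M N : Config} {e : ℕ} (cutE : Cut N e) where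

  -- M has a boundary before position p = 2 + a of the progression, but N has a
  -- 4-tile ending at p.  The marks carry this misalignment along to the end,
  -- where both have a boundary.
  overrun₀ : ∀ {a} (t : Tiling M e a) → All (N ∋_) (marks 0F t) →
    Cut N (1 + a) → S N (2 + a) ≡ false → U N a ≡ true → ⊥
  overrun₀ done _ _ _ hu = clash hu (proj₁ (proj₂ cutE))
  overrun₀ (tile₁ _ _) (m ∷ _) _ s _ = clash m s
  overrun₀ {a} (tile₄ _ t) (m ∷ ms) c _ _ with tile N (1 + a) c
  ... | inj₁ (sp , _) = clash m (SpokeAt.u₀ sp)
  ... | inj₂ (q , c′) = overrun₀ t ms c′ (QuadAt.s₃ q) (QuadAt.u₁ q)

  -- The same with the boundary of M one position before p.
  overrun₁ : ∀ {a} (t : Tiling M e a) → All (N ∋_) (marks 1F t) →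
    Cut N (2 + a) → S N (3 + a) ≡ false → U N (1 + a) ≡ true → ⊥
  overrun₁ done _ _ _ hu = clash hu (proj₂ (proj₂ cutE))
  overrun₁ (tile₁ _ t) ms c s hu = overrun₀ t ms c s hu
  overrun₁ {a} (tile₄ _ t) (m ∷ ms) c _ _ with tile N (2 + a) c
  ... | inj₁ (sp , _) = clash m (SpokeAt.v₀ sp)
  ... | inj₂ (q , c′) = overrun₁ t ms c′ (QuadAt.s₃ q) (QuadAt.u₁ q)

  -- The first mark from here on usually falls on a label that is false in the 4-tile of `N`. The
  -- exception is phase 3 after two spokes of `M`: the term is then the last position of that
  -- 4-tile, which is an overrun. If `M` ends earlier, the 4-tile crosses the final cut.
  no-quad-over-spoke : ∀ {a} d (sp : SpokeAt M (2 + a)) (t : Tiling M e (1 + a)) →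
    All (N ∋_) (marks d (tile₁ sp t)) → QuadAt N (2 + a) → Cut N (4 + a) → ⊥
  no-quad-over-spoke 0F _ _ (m ∷ _) q _ = clash m (QuadAt.s₀ q)
  no-quad-over-spoke (suc _) _ done _ q _ = clash (QuadAt.v₀ q) (proj₁ cutE)
  no-quad-over-spoke 1F _ (tile₁ _ _) (m ∷ _) q _ = clash m (QuadAt.s₁ q)
  no-quad-over-spoke 1F _ (tile₄ _ _) (m ∷ _) q _ = clash m (QuadAt.u₂ q)
  no-quad-over-spoke 2F _ (tile₁ _ done) _ q _ = clash (QuadAt.u₀ q) (proj₁ (proj₂ cutE))
  no-quad-over-spoke 2F _ (tile₁ _ (tile₁ _ _)) (m ∷ _) q _ = clash m (QuadAt.s₂ q)
  no-quad-over-spoke 2F _ (tile₁ _ (tile₄ _ _)) (m ∷ _) q _ = clash m (QuadAt.u₃ q)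
  no-quad-over-spoke 2F _ (tile₄ _ _) (m ∷ _) q _ = clash m (QuadAt.v₃ q)
  no-quad-over-spoke 3F _ (tile₁ _ t) ms q c = overrun₁ t ms c (QuadAt.s₃ q) (QuadAt.u₁ q)
  no-quad-over-spoke 3F _ (tile₄ _ _) (m ∷ _) q _ = clash m (QuadAt.v₁ q)

  -- In phases 2 and 3 the mark shares a vertex with the spoke. In phases 0 and 1 the mark can only
  -- be reached by one or two spokes of `N` followed by a 4-tile, and that 4-tile ends at the next
  -- term.
  no-spoke-over-quad : ∀ {a} d (q : QuadAt M (2 + a)) (t : Tiling M e (4 + a)) →
    All (N ∋_) (marks d (tile₄ q t)) → SpokeAt N (2 + a) → Cut N (1 + a) → ⊥
  no-spoke-over-quad {a} 0F _ t (m ∷ ms) _ c with tile N (1 + a) c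
  ... | inj₁ (sp , _) = clash m (SpokeAt.u₀ sp)
  ... | inj₂ (q , c′) = overrun₀ t ms c′ (QuadAt.s₃ q) (QuadAt.u₁ q)
  no-spoke-over-quad {a} 1F _ t (m ∷ ms) _ c with tile N (1 + a) c
  ... | inj₂ (q , _) = clash m (QuadAt.v₁ q)
  ... | inj₁ (_ , c′) with tile N (2 + a) c′
  ...   | inj₁ (sp , _) = clash m (SpokeAt.v₀ sp)
  ...   | inj₂ (q , c″) = overrun₁ t ms c″ (QuadAt.s₃ q) (QuadAt.u₁ q)
  no-spoke-over-quad 2F _ _ (m ∷ _) sp _ = clash m (SpokeAt.v₀ sp)
  no-spoke-over-quad 3F _ _ (m ∷ _) sp _ = clash m (SpokeAt.u₀ sp)

both : ∀ {x y b : Bool} → x ≡ b → y ≡ b → x ≡ y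
both p q = trans p (sym q)

agree-spoke : ∀ {M N p} → SpokeAt M p → SpokeAt N p → Agree M N p
agree-spoke m n 0F = both (SpokeAt.u₀ m) (SpokeAt.u₀ n)
agree-spoke m n 1F = both (SpokeAt.s₀ m) (SpokeAt.s₀ n)
agree-spoke m n 2F = both (SpokeAt.v₀ m) (SpokeAt.v₀ n)

agree-quad : ∀ {M N p} → QuadAt M p → QuadAt N p → ∀ {j} → j < 4 → Agree M N (j + p)
agree-quad m n {0} _ 0F = both (QuadAt.u₀ m) (QuadAt.u₀ n)
agree-quad m n {0} _ 1F = both (QuadAt.s₀ m) (QuadAt.s₀ n)
agree-quad m n {0} _ 2F = both (QuadAt.v₀ m) (QuadAt.v₀ n)
agree-quad m n {1} _ 0F = both (QuadAt.u₁ m) (QuadAt.u₁ n)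
agree-quad m n {1} _ 1F = both (QuadAt.s₁ m) (QuadAt.s₁ n)
agree-quad m n {1} _ 2F = both (QuadAt.v₁ m) (QuadAt.v₁ n)
agree-quad m n {2} _ 0F = both (QuadAt.u₂ m) (QuadAt.u₂ n)
agree-quad m n {2} _ 1F = both (QuadAt.s₂ m) (QuadAt.s₂ n)
agree-quad m n {2} _ 2F = both (QuadAt.v₂ m) (QuadAt.v₂ n)
agree-quad m n {3} _ 0F = both (QuadAt.u₃ m) (QuadAt.u₃ n)
agree-quad m n {3} _ 1F = both (QuadAt.s₃ m) (QuadAt.s₃ n)
agree-quad m n {3} _ 2F = both (QuadAt.v₃ m) (QuadAt.v₃ n)
agree-quad m n {suc (suc (suc (suc _)))} (s≤s (s≤s (s≤s (s≤s ()))))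

-- Induction along the tiling of `M`: at a common cut the two exclusions above make the next tiles
-- equal in kind, so the next cut is common as well.
marks-force : ∀ {M N e a} d (t : Tiling M e a) → Cut N e → Cut N a →
  All (N ∋_) (marks d t) → ∀ j → j + a < e → Agree M N (j + (2 + a))
marks-force d done _ _ _ j j+a<a = contradiction j+a<a (≤⇒≯ (m≤n+m _ j))
marks-force {N = N} {a = a} d (tile₁ sp t) ce c ms j j< with tile N a c
... | inj₂ (q , c′) = ⊥-elim (no-quad-over-spoke ce d sp t ms q c′)
marks-force d (tile₁ sp t) ce c ms zero j< | inj₁ (sp′ , c′) = agree-spoke sp sp′
marks-force {M} {N} {e} {a} d (tile₁ sp t) ce c ms (suc j) j< | inj₁ (sp′ , c′) =
  subst (Agree M N) (+-suc j (2 + a))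
    (marks-force {N = N} (advance d) t ce c′ (rest d ms) j (subst (_< e) (sym (+-suc j a)) j<))
  where
  rest : ∀ d → All (N ∋_) (marks d (tile₁ sp t)) → All (N ∋_) (marks (advance d) t)
  rest 0F      (_ ∷ ms) = ms
  rest (suc _) ms       = ms
marks-force {N = N} {a = a} d (tile₄ q t) ce c ms j j< with tile N a c
... | inj₁ (sp , c′) = ⊥-elim (no-spoke-over-quad ce d q t ms sp c′)
marks-force {M} {N} {e} {a} d (tile₄ q t) ce c (_ ∷ ms) j j< | inj₂ (q′ , c′) = go j j<
  where
  go : ∀ j → j + a < e → Agree M N (j + (2 + a))
  go 0 _ = agree-quad q q′ (s≤s z≤n)
  go 1 _ = agree-quad q q′ (s≤s (s≤s z≤n))
  go 2 _ = agree-quad q q′ (s≤s (s≤s (s≤s z≤n)))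
  go 3 _ = agree-quad q q′ (s≤s (s≤s (s≤s (s≤s z≤n))))
  go (suc (suc (suc (suc j)))) j< =
    subst (Agree M N) (m+4+a j (2 + a))
      (marks-force {N = N} d t ce c′ ms j (subst (_< e) (sym (m+4+a j a)) j<))

-- Recovering a cut from few edges

cut-at-spoke : ∀ N {a} → S N (2 + a) ≡ true → U N (1 + a) ≡ false → Cut N a
cut-at-spoke N {a} s hu = let v₁ , u₀ = local s (oneV N (1 + a)) (oneU N a) in v₁ , u₀ , hu
  where
  local : ∀ {s v₁ v₂ u₀ u₂} → s ≡ true → One v₁ v₂ s → One u₀ u₂ s → v₁ ≡ false × u₀ ≡ false
  local refl one₃ one₃ = refl , refl

cut-before-u : ∀ N {a} → S N (2 + a) ≡ true → U N (3 + a) ≡ true → Cut N a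
cut-before-u N {a} s hu = cut-at-spoke N s (local hu (oneU N (1 + a)))
  where
  local : ∀ {u₁ u₃ s} → u₃ ≡ true → One u₁ u₃ s → u₁ ≡ false
  local refl one₂ = refl

-- Both u-neighbours of `u_{4+a}` are on spokes, so it is too; then both v-neighbours of `v_{3+a}`
-- are on spokes, so the spoke at `3 + a` is present and excludes `u_{1+a} u_{3+a}`.
cut-between-spokes : ∀ N {a} → S N (2 + a) ≡ true → S N (6 + a) ≡ true → Cut N a
cut-between-spokes N {a} s₂ s₆ = cut-at-spoke N s₂
  (local s₂ s₆ (oneU N (2 + a)) (oneU N (4 + a)) (oneU N a)
    (oneV N (1 + a)) (oneV N (2 + a)) (oneV N (3 + a)) (oneU N (1 + a)))
  where
  local : ∀ {u₀ u₁ u₂ u₃ u₄ u₆ v₁ v₂ v₃ v₄ s₂ s₃ s₄ s₆} → s₂ ≡ true → s₆ ≡ true →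
    One u₂ u₄ s₄ → One u₄ u₆ s₆ → One u₀ u₂ s₂ →
    One v₁ v₂ s₂ → One v₂ v₃ s₃ → One v₃ v₄ s₄ → One u₁ u₃ s₃ →
    u₁ ≡ false
  local refl refl one₃ one₃ one₃ one₃ one₃ one₃ one₃ = refl

-- One edge of each of three consecutive 4-tiles, covering both kinds of
-- u-edges and the v-edges, pins down the phase.
cut-of-three-marks : ∀ N x → U N x ≡ true → U N (5 + x) ≡ true → V N (8 + x) ≡ true →
  (V N (3 + x) ≡ false × U N (2 + x) ≡ false × U N (3 + x) ≡ false) ×
  U N (4 + x) ≡ true × U N (8 + x) ≡ true
cut-of-three-marks N x u₀ u₅ v₈ =
  local u₀ u₅ v₈ (oneU N x) (oneU N (3 + x)) (oneU N (5 + x)) (oneV N (7 + x)) (oneV N (6 + x))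
    (oneV N (5 + x)) (oneV N (4 + x)) (oneV N (3 + x)) (oneU N (2 + x)) (oneU N (4 + x)) (oneU N (6 + x))
  where
  local : ∀ {u₀ u₂ u₃ u₄ u₅ u₆ u₇ u₈ v₃ v₄ v₅ v₆ v₇ v₈ s₂ s₄ s₅ s₆ s₇ s₈} →
    u₀ ≡ true → u₅ ≡ true → v₈ ≡ true →
    One u₀ u₂ s₂ → One u₃ u₅ s₅ → One u₅ u₇ s₇ → One v₇ v₈ s₈ → One v₆ v₇ s₇ → One v₅ v₆ s₆ →
    One v₄ v₅ s₅ → One v₃ v₄ s₄ → One u₂ u₄ s₄ → One u₄ u₆ s₆ → One u₆ u₈ s₈ →
    (v₃ ≡ false × u₂ ≡ false × u₃ ≡ false) × u₄ ≡ true × u₈ ≡ true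
  local refl refl refl one₁ one₂ one₁ one₂ one₁ one₂ one₁ one₂ one₂ one₁ one₂ =
    (refl , refl , refl) , refl , refl

-- With a gap divisible by 4 the edges u_x u_{x+2} are forced from the next
-- spoke backwards.
u-before-spoke : ∀ M q x → (∀ k → k < q * 4 → S M (k + x) ≡ false) → S M x ≡ false →
  S M (q * 4 + x) ≡ true → U M x ≡ true
u-before-spoke M q x gap s₀ s = descend q gap (inj₁ s)
  where
  local : ∀ {u₀ u₂ u₄ s₂ s₄} → s₂ ≡ false → s₄ ≡ true ⊎ u₄ ≡ true →
    One u₂ u₄ s₄ → One u₀ u₂ s₂ → u₀ ≡ true
  local refl (inj₁ refl) one₃ one₁ = refl
  local refl (inj₂ refl) one₂ one₁ = refl
  descend : ∀ q → (∀ k → k < q * 4 → S M (k + x) ≡ false) →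
    S M (q * 4 + x) ≡ true ⊎ U M (q * 4 + x) ≡ true → U M x ≡ true
  descend zero _ (inj₁ s) = ⊥-elim (clash s s₀)
  descend zero _ (inj₂ hu) = hu
  descend (suc q) gap su = descend q (λ k k< → gap k (≤-trans k< (m≤n+m _ 4)))
    (inj₂ (local (gap (2 + q * 4) (n≤1+n _)) su
      (oneU M (2 + (q * 4 + x))) (oneU M (q * 4 + x))))

first-true : ∀ (f : ℕ → Bool) m → f m ≡ true →
  ∃[ g ] g ≤ m × f g ≡ true × (∀ k → k < g → f k ≡ false)
first-true f m fm with f 0 in f0
... | true = 0 , z≤n , f0 , λ _ ()
first-true f zero fm | false = ⊥-elim (clash fm f0)
first-true f (suc m) fm | false with first-true (f ∘ suc) m fm
... | g , g≤m , fg , below = suc g , s≤s g≤m , fg , λ where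
  zero    _         → f0
  (suc k) (s≤s k<g) → below k k<g

-- Applied to the spokes over one period, this finds a spoke followed by a non-spoke, or shows that
-- all spokes are present.
descent-or-constant : ∀ (f : ℕ → Bool) → f 0 ≡ true → ∀ m →
  (∃[ k ] f k ≡ true × f (1 + k) ≡ false) ⊎ (∀ j → j < m → f j ≡ true)
descent-or-constant f f0 zero = inj₂ λ _ ()
descent-or-constant f f0 (suc m) with f 1 in f1
... | false = inj₁ (0 , f0 , f1)
... | true with descent-or-constant (f ∘ suc) f1 m
...   | inj₁ (k , p) = inj₁ (suc k , p)
...   | inj₂ all = inj₂ λ where
  zero    _         → f0
  (suc j) (s≤s j<m) → all j j<m

-- Forcing among periodic configurations

module _ (n : ℕ) .{{_ : NonZero n}} where

  Periodic : Config → Set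
  Periodic N = ∀ l {j k} → j % n ≡ k % n → has N l j ≡ has N l k

  [n+k]%n : ∀ k → (n + k) % n ≡ k % n
  [n+k]%n k = trans (cong (_% n) (+-comm n k)) ([m+n]%n≡m%n k n)

  cut-cong : ∀ {N a b} → Periodic N → (∀ j → (j + a) % n ≡ (j + b) % n) → Cut N a → Cut N b
  cut-cong {N} per eq (v₁ , u₀ , u₁) =
    trans (per 2F (sym (eq 1))) v₁ , trans (per 0F (sym (eq 0))) u₀ , trans (per 0F (sym (eq 1))) u₁

  [j+n+k]%n : ∀ k j → (j + (n + k)) % n ≡ (j + k) % n
  [j+n+k]%n k j = trans (cong (_% n) (x∙yz≈y∙xz j n k)) ([n+k]%n (j + k))

  cut-shift : ∀ {N a} → Periodic N → Cut N a → Cut N (n + a)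
  cut-shift {N} {a} per = cut-cong {N} per (λ j → sym ([j+n+k]%n a j))

  residue-in-window : ∀ a k → ∃[ j ] j < n × (j + a) % n ≡ k % n
  residue-in-window a k = j , m%n<n _ n , (begin
    (j + a) % n                          ≡⟨ %-distribˡ-+ j a n ⟩
    (j % n + a % n) % n                  ≡⟨ cong (λ r → (r + a % n) % n) (m%n%n≡m%n _ n) ⟩
    ((k + (a * n ∸ a)) % n + a % n) % n  ≡⟨ %-distribˡ-+ (k + (a * n ∸ a)) a n ⟨
    (k + (a * n ∸ a) + a) % n            ≡⟨ cong (_% n) (+-assoc k _ a) ⟩
    (k + (a * n ∸ a + a)) % n            ≡⟨ cong (λ r → (k + r) % n) (m∸n+n≡m (m≤m*n a n)) ⟩
    (k + a * n) % n                      ≡⟨ [m+kn]%n≡m%n k a n ⟩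
    k % n                                ∎)
    where
    open ≡-Reasoning
    j : ℕ
    -- As `a ≤ a * n`, the number `a * n ∸ a` represents `- a` modulo `n`.
    j = (k + (a * n ∸ a)) % n

  agree-everywhere : ∀ {M N} a → Periodic M → Periodic N →
    (∀ j → j < n → Agree M N (j + a)) → ∀ l k → has M l k ≡ has N l k
  agree-everywhere a perM perN agree l k with residue-in-window a k
  ... | j , j<n , eq = trans (perM l (sym eq)) (trans (agree j j<n l) (perN l eq))

  -- The bound says length L ≤ ⌈ n /4⌉.
  Forcible : Config → Set
  Forcible M = ∃[ L ] All (M ∋_) L × 4 * length L ≤ 3 + n ×
    (∀ N → Periodic N → All (N ∋_) L → ∀ l k → has M l k ≡ has N l k)

  -- The cut of `N` at `a` recurs at `n + a`, so `marks-force` applies to one full turn, which meets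
  -- every residue.
  forces-from-cut : ∀ {M N a} d → Periodic M → Periodic N → (t : Tiling M (n + a) a) →
    Cut N a → All (N ∋_) (marks d t) → ∀ l k → has M l k ≡ has N l k
  forces-from-cut {M} {N} {a} d perM perN t c ms = agree-everywhere {M} {N} (2 + a) perM perN λ j j<n →
    marks-force {N = N} d t (cut-shift {N} perN c) c ms j (+-monoˡ-< a j<n)

  -- In phase 0 the first position is itself a term and `length-marks` gives the bound of
  -- `Forcible`. What remains is that the marks alone produce the initial cut in `N`.
  forcible-at : ∀ {M a} → Periodic M → (t : Tiling M (n + a) a) →
    (∀ N → All (N ∋_) (marks 0F t) → Cut N a) → Forcible M
  forcible-at {M} {a} per t cutN =
    marks 0F t , marks-∈ 0F t , +-cancelʳ-≤ a _ _ size ,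
    λ N perN ms → forces-from-cut {N = N} 0F per perN t (cutN N ms) ms
    where
    size : 4 * length (marks 0F t) + a ≤ 3 + n + a
    size = subst (_≤ 3 + n + a) (cong (_+ a) (+-identityʳ (4 * length (marks 0F t)))) (length-marks 0F t)

  -- After the marked spoke the phase is 3, so the second mark is the edge `u_{3+a} u_{5+a}` of the
  -- next 4-tile. By `cut-before-u` these two marks force the initial cut.
  forcible-before-quad : ∀ {M a} → 2 ≤ n → Periodic M →
    S M (2 + a) ≡ true → U M (3 + a) ≡ true → Forcible M
  forcible-before-quad {M} {a} 2≤n per s hu =
    forcible-at per t (λ N ms → cutN N (+-monoˡ-≤ a 2≤n) t ms)
    where
    c : Cut M a
    c = cut-before-u M s hu
    t : Tiling M (n + a) a
    t = tiling M n refl c (cut-shift {M} per c)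
    cutN : ∀ N {e} → 2 + a ≤ e → (t : Tiling M e a) → All (N ∋_) (marks 0F t) → Cut N a
    cutN N lt done _ = contradiction lt (<⇒≱ (m≤n+m _ 1))
    cutN N lt (tile₄ q t) ms = ⊥-elim (clash s (QuadAt.s₀ q))
    cutN N lt (tile₁ _ done) ms = contradiction lt (<⇒≱ ≤-refl)
    cutN N lt (tile₁ _ (tile₁ sp _)) ms = ⊥-elim (clash hu (SpokeAt.u₀ sp))
    cutN N lt (tile₁ _ (tile₄ q _)) (m ∷ m′ ∷ _) = cut-before-u N m m′

  forcible-spokes : ∀ {M} → 5 ≤ n → Periodic M → (∀ k → S M k ≡ true) → Forcible M
  forcible-spokes {M} 5≤n per s =
    forcible-at per t (λ N ms → cutN N (+-monoˡ-≤ 0 5≤n) t ms)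
    where
    c : Cut M 0
    c = cut-between-spokes M (s 2) (s 6)
    t : Tiling M (n + 0) 0
    t = tiling M n refl c (cut-shift {M} per c)
    cutN : ∀ N {e} → 5 ≤ e → (t : Tiling M e 0) → All (N ∋_) (marks 0F t) → Cut N 0
    -- The first two marks are the spokes at 2 and 6, that is, the first and the fifth tile.
    cutN N lt (tile₁ _ (tile₁ _ (tile₁ _ (tile₁ _ (tile₁ _ _))))) (m ∷ m′ ∷ _) =
      cut-between-spokes N m m′
    cutN N lt (tile₄ q _) _ = ⊥-elim (clash (s _) (QuadAt.s₀ q))
    cutN N lt (tile₁ _ (tile₄ q _)) _ = ⊥-elim (clash (s _) (QuadAt.s₀ q))
    cutN N lt (tile₁ _ (tile₁ _ (tile₄ q _))) _ = ⊥-elim (clash (s _) (QuadAt.s₀ q))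
    cutN N lt (tile₁ _ (tile₁ _ (tile₁ _ (tile₄ q _)))) _ = ⊥-elim (clash (s _) (QuadAt.s₀ q))
    cutN N lt (tile₁ _ (tile₁ _ (tile₁ _ (tile₁ _ (tile₄ q _))))) _ =
      ⊥-elim (clash (s _) (QuadAt.s₀ q))
    cutN N (s≤s ()) (tile₁ _ done) _
    cutN N (s≤s (s≤s ())) (tile₁ _ (tile₁ _ done)) _
    cutN N (s≤s (s≤s (s≤s ()))) (tile₁ _ (tile₁ _ (tile₁ _ done))) _
    cutN N (s≤s (s≤s (s≤s (s≤s ())))) (tile₁ _ (tile₁ _ (tile₁ _ (tile₁ _ done)))) _

  spokeless-quad : ∀ {M a} → (∀ k → S M k ≡ false) → Cut M a → QuadAt M (2 + a) × Cut M (4 + a)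
  spokeless-quad {M} {a} s c with tile M a c
  ... | inj₁ (sp , _) = ⊥-elim (clash (SpokeAt.s₀ sp) (s _))
  ... | inj₂ q = q

  -- In phase 3 the mark of a 4-tile at `p` is `u_p u_{p+2}`; it excludes the spoke at `p`, so the
  -- cut of `N` moves on with that of `M`.
  spokeless-cut : ∀ {M N e a} → (∀ k → S M k ≡ false) → (t : Tiling M e a) →
    All (N ∋_) (marks 3F t) → Cut N a → Cut N e
  spokeless-cut s done _ c = c
  spokeless-cut s (tile₁ sp _) _ _ = ⊥-elim (clash (SpokeAt.s₀ sp) (s _))
  spokeless-cut {N = N} {a = a} s (tile₄ _ t) (m ∷ ms) c with tile N a c
  ... | inj₁ (sp , _) = ⊥-elim (clash m (SpokeAt.u₀ sp))
  ... | inj₂ (_ , c′) = spokeless-cut {N = N} s t ms c′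

  -- The phase 3 marks of the second and third 4-tile are replaced by a u-edge of the other kind and
  -- a v-edge. `cut-of-three-marks` then yields the cut after the first tile and both replaced
  -- marks. `spokeless-cut` carries this cut to `n + a`, hence to `a` by periodicity, and forcing
  -- from a cut applies.
  forcible-spokeless : ∀ {M a} m → n ≡ 12 + m → Periodic M →
    (∀ k → S M k ≡ false) → Cut M a → Forcible M
  forcible-spokeless {M} {a} m n≡ per s c₀ =
    (0F , 2 + a) ∷ (0F , 7 + a) ∷ (2F , 10 + a) ∷ marks 3F t ,
    u₀ q₀ ∷ u₁ q₁ ∷ v₀ q₂ ∷ marks-∈ 3F t ,
    +-cancelʳ-≤ (3 + a) _ _ size ,
    force
    where
    open QuadAt
    q₀ : QuadAt M (2 + a)
    q₀ = proj₁ (spokeless-quad {M} s c₀)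
    c₁ : Cut M (4 + a)
    c₁ = proj₂ (spokeless-quad {M} s c₀)
    q₁ : QuadAt M (6 + a)
    q₁ = proj₁ (spokeless-quad {M} s c₁)
    c₂ : Cut M (8 + a)
    c₂ = proj₂ (spokeless-quad {M} s c₁)
    q₂ : QuadAt M (10 + a)
    q₂ = proj₁ (spokeless-quad {M} s c₂)
    c₃ : Cut M (12 + a)
    c₃ = proj₂ (spokeless-quad {M} s c₂)
    t : Tiling M (n + a) (12 + a)
    t = tiling M m (trans (arith m a) (cong (_+ a) (sym n≡))) c₃ (cut-shift {M} per c₀)
      where
      arith : ∀ m a → m + (12 + a) ≡ 12 + m + a
      arith = solve 2 (λ m a → m :+ (con 12 :+ a) := con 12 :+ m :+ a) refl
        where open +-*-Solver
    size : 4 * (3 + length (marks 3F t)) + (3 + a) ≤ 3 + n + (3 + a)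
    size = begin
      4 * (3 + L) + (3 + a)    ≡⟨ arith L a ⟩
      4 * L + 3 + (12 + a)     ≤⟨ length-marks 3F t ⟩
      3 + (n + a)              ≤⟨ m≤n+m _ 3 ⟩
      3 + (3 + (n + a))        ≡⟨ arith′ n a ⟩
      3 + n + (3 + a)          ∎
      where
      open ≤-Reasoning
      L : ℕ
      L = length (marks 3F t)
      arith : ∀ L a → 4 * (3 + L) + (3 + a) ≡ 4 * L + 3 + (12 + a)
      arith = solve 2 (λ L a →
        con 4 :* (con 3 :+ L) :+ (con 3 :+ a) := con 4 :* L :+ con 3 :+ (con 12 :+ a)) refl
        where open +-*-Solver
      arith′ : ∀ n a → 3 + (3 + (n + a)) ≡ 3 + n + (3 + a)
      arith′ = solve 2 (λ n a → con 3 :+ (con 3 :+ (n :+ a)) := con 3 :+ n :+ (con 3 :+ a)) refl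
        where open +-*-Solver
    force : ∀ N → Periodic N →
      All (N ∋_) ((0F , 2 + a) ∷ (0F , 7 + a) ∷ (2F , 10 + a) ∷ marks 3F t) →
      ∀ l k → has M l k ≡ has N l k
    force N perN (m₀ ∷ m₁ ∷ m₂ ∷ ms) with cut-of-three-marks N (2 + a) m₀ m₁ m₂
    ... | c₁′ , u₄ , u₈ =
      forces-from-cut {N = N} 3F per perN (tile₄ q₀ (tile₄ q₁ (tile₄ q₂ t))) c₀′ (m₀ ∷ u₄ ∷ u₈ ∷ ms)
      where
      cₑ : Cut N (n + a)
      cₑ = spokeless-cut {M} {N} s (tile₄ q₁ (tile₄ q₂ t)) (u₄ ∷ u₈ ∷ ms) c₁′
      c₀′ : Cut N a
      c₀′ = cut-cong {N} perN ([j+n+k]%n a) cₑ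

  -- With `j = 1 + g + i` the gap is `g` itself, and `g < n` says `j ≤ i + n`.
  GapsDivisibleBy4 : Config → Set
  GapsDivisibleBy4 M = ∀ i g → g < n → S M i ≡ true → S M (1 + g + i) ≡ true →
    (∀ k → k < g → S M (1 + k + i) ≡ false) → 4 ∣ g

  -- At a spoke followed by a non-spoke, divisibility of the gap gives the u-edge that
  -- `forcible-before-quad` asks for.
  forcible-spoked : ∀ {M} k → 9 ≤ n → Periodic M → S M k ≡ true →
    GapsDivisibleBy4 M → Forcible M
  forcible-spoked {M} k 9≤n per sk gaps
    -- The search starts one period after `k`, so the spoke found has an index of the form `2 + a`.
    with descent-or-constant (λ j → S M (j + (n + k))) (trans (per 1F ([n+k]%n k)) sk) n
  ... | inj₂ all = forcible-spokes {M} (≤-trans (m≤n+m 5 4) 9≤n) per λ x →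
    let j , j<n , eq = residue-in-window (n + k) x in trans (per 1F (sym eq)) (all j j<n)
  ... | inj₁ (j , s , s′) = at-descent (j + (n + k))
    (≤-trans (m≤n+m 2 7) (≤-trans 9≤n (≤-trans (m≤m+n n k) (m≤n+m _ j)))) s s′
    where
    at-descent : ∀ i → 2 ≤ i → S M i ≡ true → S M (1 + i) ≡ false → Forcible M
    at-descent 1 (s≤s ())
    at-descent (suc (suc a)) _ s s′
      -- The spoke at `2 + a` recurs after a full turn, so a next spoke lies at most `n ∸ 1`
      -- positions beyond `3 + a`.
      with first-true (λ g → S M (g + (3 + a))) (n ∸ 1)
             (trans (per 1F (trans (cong (_% n) wrap) ([n+k]%n (2 + a)))) s)
      where
      wrap : n ∸ 1 + (3 + a) ≡ n + (2 + a)
      wrap = trans (+-suc (n ∸ 1) (2 + a)) (cong (_+ (2 + a)) (suc-pred n))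
    ... | g , g≤ , sg , below
      with gaps (2 + a) g (≤-trans (s≤s g≤) (≤-reflexive (suc-pred n))) s
             (trans (cong (S M) (sym (+-suc g (2 + a)))) sg)
             (λ k k<g → trans (cong (S M) (sym (+-suc k (2 + a)))) (below k k<g))
    ...   | divides q refl = forcible-before-quad {M} (≤-trans (m≤n+m 2 7) 9≤n) per s
                               (u-before-spoke M q (3 + a) below s′ sg)

-- Perfect matchings of P(n, 2) as periodic configurations

subset-ext : ∀ {m} {p q : Subset m} → (∀ x → lookup p x ≡ lookup q x) → p ≡ q
subset-ext {p = p} {q} eq = trans (sym (tabulate∘lookup p)) (trans (tabulate-cong eq) (tabulate∘lookup q))

∉⇒lookup : ∀ {m} {p : Subset m} {x} → x ∉ p → lookup p x ≡ false
∉⇒lookup {p = p} {x} x∉p with lookup p x in eq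
... | true  = ⊥-elim (x∉p (lookup⇒[]= x p eq))
... | false = refl

lookup⇒∉ : ∀ {m} {p : Subset m} {x} → lookup p x ≡ false → x ∉ p
lookup⇒∉ eq x∈p = clash ([]=⇒lookup x∈p) eq

∣p∪q∣≤∣p∣+∣q∣ : ∀ {m} (p q : Subset m) → ∣ p ∪ q ∣ ≤ ∣ p ∣ + ∣ q ∣
∣p∪q∣≤∣p∣+∣q∣ [] [] = z≤n
∣p∪q∣≤∣p∣+∣q∣ (true ∷ p) (true ∷ q) =
  s≤s (≤-trans (∣p∪q∣≤∣p∣+∣q∣ p q) (+-monoʳ-≤ ∣ p ∣ (n≤1+n _)))
∣p∪q∣≤∣p∣+∣q∣ (true ∷ p) (false ∷ q) = s≤s (∣p∪q∣≤∣p∣+∣q∣ p q)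
∣p∪q∣≤∣p∣+∣q∣ (false ∷ p) (true ∷ q) =
  ≤-trans (s≤s (∣p∪q∣≤∣p∣+∣q∣ p q)) (≤-reflexive (sym (+-suc ∣ p ∣ ∣ q ∣)))
∣p∪q∣≤∣p∣+∣q∣ (false ∷ p) (false ∷ q) = ∣p∪q∣≤∣p∣+∣q∣ p q

fromList : ∀ {A : Set} {m} → (A → Fin m) → List A → Subset m
fromList f xs = ⋃ (map (⁅_⁆ ∘ f) xs)

∣fromList∣≤ : ∀ {A : Set} {m} (f : A → Fin m) xs → ∣ fromList f xs ∣ ≤ length xs
∣fromList∣≤ {m = m} f [] = ≤-reflexive (∣⊥∣≡0 m)
∣fromList∣≤ f (x ∷ xs) = ≤-trans (∣p∪q∣≤∣p∣+∣q∣ ⁅ f x ⁆ (fromList f xs))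
  (+-mono-≤ (≤-reflexive (∣⁅x⁆∣≡1 (f x))) (∣fromList∣≤ f xs))

fromList-⊆ : ∀ {A : Set} {m} (f : A → Fin m) {p xs} → All (λ x → f x ∈ p) xs → fromList f xs ⊆ p
fromList-⊆ f [] x∈ = ⊥-elim (∉⊥ x∈)
fromList-⊆ f {p} {x ∷ xs} (fx∈p ∷ rest) {y} y∈ with x∈p∪q⁻ ⁅ f x ⁆ (fromList f xs) y∈
... | inj₁ y∈x = subst (_∈ p) (sym (x∈⁅y⁆⇒x≡y (f x) y∈x)) fx∈p
... | inj₂ y∈xs = fromList-⊆ f rest y∈xs

⊆-fromList : ∀ {A : Set} {m} (f : A → Fin m) {p} xs → fromList f xs ⊆ p → All (λ x → f x ∈ p) xs
⊆-fromList f [] _ = []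
⊆-fromList f (x ∷ xs) sub =
  sub (x∈p∪q⁺ (inj₁ (x∈⁅x⁆ (f x)))) ∷ ⊆-fromList f xs (λ y∈ → sub (x∈p∪q⁺ (inj₂ y∈)))

-- The equation is a hypothesis because `upTo (n / 4)` unfolds only once `n / 4` is known to be a
-- successor.
first∈⋃ : ∀ {m} {f : ℕ → Subset m} {x k l} → k ≡ suc l → x ∈ f 0 → x ∈ ⋃ (map f (upTo k))
first∈⋃ refl x∈ = x∈p∪q⁺ (inj₁ x∈)

-- Unique incidence at a vertex of degree three

module _ {m} (N : Subset m) {I : Fin m → Set} {e₁ e₂ e₃ : Fin m}
  (e₁≢e₂ : e₁ ≢ e₂) (e₁≢e₃ : e₁ ≢ e₃) (e₂≢e₃ : e₂ ≢ e₃)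
  (only : ∀ e → I e → e ≡ e₁ ⊎ e ≡ e₂ ⊎ e ≡ e₃)
  (i₁ : I e₁) (i₂ : I e₂) (i₃ : I e₃) where

  private
    same : ∀ {e x y} → (∀ {y} → y ∈ N × I y → e ≡ y) →
      lookup N x ≡ true → I x → lookup N y ≡ true → I y → x ≡ y
    same unique x∈ ix y∈ iy =
      trans (sym (unique (lookup⇒[]= _ _ x∈ , ix))) (unique (lookup⇒[]= _ _ y∈ , iy))

  ∃!⇒One : ∃! _≡_ (λ e → e ∈ N × I e) → One (lookup N e₁) (lookup N e₂) (lookup N e₃)
  ∃!⇒One (e , (e∈N , ie) , unique)
    with lookup N e₁ in eq₁ | lookup N e₂ in eq₂ | lookup N e₃ in eq₃
  ... | true  | true  | _     = ⊥-elim (e₁≢e₂ (same unique eq₁ i₁ eq₂ i₂))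
  ... | true  | false | true  = ⊥-elim (e₁≢e₃ (same unique eq₁ i₁ eq₃ i₃))
  ... | false | true  | true  = ⊥-elim (e₂≢e₃ (same unique eq₂ i₂ eq₃ i₃))
  ... | true  | false | false = one₁
  ... | false | true  | false = one₂
  ... | false | false | true  = one₃
  ... | false | false | false with only e ie
  ...   | inj₁ refl        = ⊥-elim (lookup⇒∉ eq₁ e∈N)
  ...   | inj₂ (inj₁ refl) = ⊥-elim (lookup⇒∉ eq₂ e∈N)
  ...   | inj₂ (inj₂ refl) = ⊥-elim (lookup⇒∉ eq₃ e∈N)

  One⇒∃! : One (lookup N e₁) (lookup N e₂) (lookup N e₃) → ∃! _≡_ (λ e → e ∈ N × I e)
  One⇒∃! one with lookup N e₁ in eq₁ | lookup N e₂ in eq₂ | lookup N e₃ in eq₃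
  One⇒∃! one₁ | _ | _ | _ = e₁ , (lookup⇒[]= _ _ eq₁ , i₁) , λ (y∈ , iy) → case only _ iy of λ where
    (inj₁ eq)          → sym eq
    (inj₂ (inj₁ refl)) → ⊥-elim (lookup⇒∉ eq₂ y∈)
    (inj₂ (inj₂ refl)) → ⊥-elim (lookup⇒∉ eq₃ y∈)
  One⇒∃! one₂ | _ | _ | _ = e₂ , (lookup⇒[]= _ _ eq₂ , i₂) , λ (y∈ , iy) → case only _ iy of λ where
    (inj₁ refl)        → ⊥-elim (lookup⇒∉ eq₁ y∈)
    (inj₂ (inj₁ eq))   → sym eq
    (inj₂ (inj₂ refl)) → ⊥-elim (lookup⇒∉ eq₃ y∈)
  One⇒∃! one₃ | _ | _ | _ = e₃ , (lookup⇒[]= _ _ eq₃ , i₃) , λ (y∈ , iy) → case only _ iy of λ where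
    (inj₁ refl)        → ⊥-elim (lookup⇒∉ eq₁ y∈)
    (inj₂ (inj₁ refl)) → ⊥-elim (lookup⇒∉ eq₂ y∈)
    (inj₂ (inj₂ eq))   → sym eq

  ∃!⇔One : ∃! _≡_ (λ e → e ∈ N × I e) ⇔ One (lookup N e₁) (lookup N e₂) (lookup N e₃)
  ∃!⇔One = mk⇔ ∃!⇒One One⇒∃!

-- Edges of P(n,2) by labels modulo n

module _ (n : ℕ) .{{_ : NonZero n}} where

  open Graph (P n) using (Edge; EdgeSet; ends)

  edge : Label → Edge
  edge (l , k) = combine l (k mod n)

  toℕ-mod : ∀ k → toℕ (k mod n) ≡ k % n
  toℕ-mod k = toℕ-fromℕ< (m%n<n k n)

  mod-cong : ∀ {j k} → j % n ≡ k % n → j mod n ≡ k mod n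
  mod-cong {j} {k} eq = toℕ-injective (trans (toℕ-mod j) (trans eq (sym (toℕ-mod k))))

  mod-injective : ∀ {j k} → j mod n ≡ k mod n → j % n ≡ k % n
  mod-injective {j} {k} eq = trans (sym (toℕ-mod j)) (trans (cong toℕ eq) (toℕ-mod k))

  toℕ-mod-inverse : ∀ (i : Fin n) → toℕ i mod n ≡ i
  toℕ-mod-inverse i = toℕ-injective (trans (toℕ-mod (toℕ i)) (m<n⇒m%n≡m (toℕ<n i)))

  %-+ʳ : ∀ d k → (d + k % n) % n ≡ (d + k) % n
  %-+ʳ d k = begin
    (d + k % n) % n          ≡⟨ %-distribˡ-+ d (k % n) n ⟩
    (d % n + k % n % n) % n  ≡⟨ cong (λ r → (d % n + r) % n) (m%n%n≡m%n k n) ⟩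
    (d % n + k % n) % n      ≡⟨ %-distribˡ-+ d k n ⟨
    (d + k) % n              ∎
    where open ≡-Reasoning

  +-%-congˡ : ∀ d {j k} → j % n ≡ k % n → (d + j) % n ≡ (d + k) % n
  +-%-congˡ d {j} {k} eq = trans (sym (%-+ʳ d j)) (trans (cong (λ r → (d + r) % n) eq) (%-+ʳ d k))

  +-%-cancelˡ : ∀ d {j k} → (d + j) % n ≡ (d + k) % n → j % n ≡ k % n
  +-%-cancelˡ d {j} {k} eq =
    trans (sym (undo j)) (trans (+-%-congˡ (d * n ∸ d) eq) (undo k))
    where
    -- Again `d * n ∸ d` represents `- d` modulo `n`.
    undo : ∀ j → (d * n ∸ d + (d + j)) % n ≡ j % n
    undo j = begin
      (d * n ∸ d + (d + j)) % n  ≡⟨ cong (_% n) (+-assoc (d * n ∸ d) d j) ⟨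
      (d * n ∸ d + d + j) % n    ≡⟨ cong (λ r → (r + j) % n) (m∸n+n≡m (m≤m*n d n)) ⟩
      (d * n + j) % n            ≡⟨ cong (_% n) (+-comm (d * n) j) ⟩
      (j + d * n) % n            ≡⟨ [m+kn]%n≡m%n j d n ⟩
      j % n                      ∎
      where open ≡-Reasoning

  ⊕-mod : ∀ k d → _⊕_ n (k mod n) d ≡ (d + k) mod n
  ⊕-mod k d = mod-cong (begin
    (toℕ (k mod n) + d) % n  ≡⟨ cong (_% n) (+-comm (toℕ (k mod n)) d) ⟩
    (d + toℕ (k mod n)) % n  ≡⟨ cong (λ r → (d + r) % n) (toℕ-mod k) ⟩
    (d + k % n) % n          ≡⟨ %-+ʳ d k ⟩
    (d + k) % n              ∎)
    where open ≡-Reasoning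

  edge-cong : ∀ l {j k} → j % n ≡ k % n → edge (l , j) ≡ edge (l , k)
  edge-cong l eq = cong (combine l) (mod-cong eq)

  edge-surjective : ∀ e → ∃[ l ] ∃[ k ] k < n × e ≡ edge (l , k)
  edge-surjective e = l , toℕ i , toℕ<n i ,
    trans (sym (combine-remQuot n e)) (cong (combine l) (sym (toℕ-mod-inverse i)))
    where
    l : Fin 3
    l = proj₁ (remQuot {3} n e)
    i : Fin n
    i = proj₂ (remQuot {3} n e)

  remQuot-edge : ∀ l k → remQuot {3} n (edge (l , k)) ≡ (l , k mod n)
  remQuot-edge l k = remQuot-combine l (k mod n)

  edge-injective : ∀ {l m j k} → edge (l , j) ≡ edge (m , k) → l ≡ m × j % n ≡ k % n
  edge-injective {l} {m} {j} {k} eq = cong proj₁ eq′ , mod-injective (cong proj₂ eq′)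
    where
    eq′ : (l , j mod n) ≡ (m , k mod n)
    eq′ = trans (sym (remQuot-edge l j)) (trans (cong (remQuot {3} n) eq) (remQuot-edge m k))

  edgeEnds : Label → PVertex n × PVertex n
  edgeEnds (0F , k) = u (k mod n) , u ((2 + k) mod n)
  edgeEnds (1F , k) = u (k mod n) , v (k mod n)
  edgeEnds (2F , k) = v (k mod n) , v ((1 + k) mod n)

  ends-edge : ∀ l k → ends (edge (l , k)) ≡ edgeEnds (l , k)
  ends-edge l k = trans (cong (labelEnds n) (remQuot-edge l k)) (step l)
    where
    step : ∀ l → labelEnds n (l , k mod n) ≡ edgeEnds (l , k)
    step 0F = cong (λ i → u (k mod n) , u i) (⊕-mod k 2)
    step 1F = refl
    step 2F = cong (λ i → v (k mod n) , v i) (⊕-mod k 1)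

  IncidentTo : PVertex n → Label → Set
  IncidentTo x e = x ≡ proj₁ (edgeEnds e) ⊎ x ≡ proj₂ (edgeEnds e)

  incident⁺ : ∀ {x} l k → IncidentTo x (l , k) → Incident (P n) (edge (l , k)) x
  incident⁺ {x} l k = subst (λ (y , z) → x ≡ y ⊎ x ≡ z) (sym (ends-edge l k))

  incident⁻ : ∀ {x} l k → Incident (P n) (edge (l , k)) x → IncidentTo x (l , k)
  incident⁻ {x} l k = subst (λ (y , z) → x ≡ y ⊎ x ≡ z) (ends-edge l k)

  u-mod-injective : ∀ {j k} → u (j mod n) ≡ u (k mod n) → j % n ≡ k % n
  u-mod-injective eq = mod-injective (u-injective′ eq)
    where
    u-injective′ : ∀ {i j : Fin n} → PVertex.u {n} i ≡ u j → i ≡ j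
    u-injective′ refl = refl

  v-mod-injective : ∀ {j k} → v (j mod n) ≡ v (k mod n) → j % n ≡ k % n
  v-mod-injective eq = mod-injective (v-injective′ eq)
    where
    v-injective′ : ∀ {i j : Fin n} → PVertex.v {n} i ≡ v j → i ≡ j
    v-injective′ refl = refl

  -- Writing the index of the vertex as `2 + k` gives the edge from behind the label `k` without
  -- subtraction, in the form of `oneU`.
  edges-at-u : ∀ k e → Incident (P n) e (u ((2 + k) mod n)) →
    e ≡ edge (0F , k) ⊎ e ≡ edge (0F , 2 + k) ⊎ e ≡ edge (1F , 2 + k)
  edges-at-u k e inc with edge-surjective e
  ... | l , j , _ , refl with l | incident⁻ l j inc
  ...   | 0F | inj₁ eq = inj₂ (inj₁ (edge-cong 0F (u-mod-injective {j} {2 + k} (sym eq))))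
  ...   | 0F | inj₂ eq =
    inj₁ (edge-cong 0F (+-%-cancelˡ 2 {j} {k} (sym (u-mod-injective {2 + k} {2 + j} eq))))
  ...   | 1F | inj₁ eq = inj₂ (inj₂ (edge-cong 1F (u-mod-injective {j} {2 + k} (sym eq))))
  ...   | 1F | inj₂ ()
  ...   | 2F | inj₁ ()
  ...   | 2F | inj₂ ()

  edges-at-v : ∀ k e → Incident (P n) e (v ((1 + k) mod n)) →
    e ≡ edge (2F , k) ⊎ e ≡ edge (2F , 1 + k) ⊎ e ≡ edge (1F , 1 + k)
  edges-at-v k e inc with edge-surjective e
  ... | l , j , _ , refl with l | incident⁻ l j inc
  ...   | 0F | inj₁ ()
  ...   | 0F | inj₂ ()
  ...   | 1F | inj₁ ()
  ...   | 1F | inj₂ eq = inj₂ (inj₂ (edge-cong 1F (v-mod-injective {j} {1 + k} (sym eq))))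
  ...   | 2F | inj₁ eq = inj₂ (inj₁ (edge-cong 2F (v-mod-injective {j} {1 + k} (sym eq))))
  ...   | 2F | inj₂ eq =
    inj₁ (edge-cong 2F (+-%-cancelˡ 1 {j} {k} (sym (v-mod-injective {1 + k} {1 + j} eq))))

  label-≢ : ∀ {l m j k} → l ≢ m → edge (l , j) ≢ edge (m , k)
  label-≢ {l} {m} {j} {k} l≢m eq = l≢m (proj₁ (edge-injective {l} {m} {j} {k} eq))

  shift-≢ : ∀ l d .{{_ : NonZero d}} k → d < n → edge (l , k) ≢ edge (l , d + k)
  shift-≢ l d k d<n eq = <⇒≢ (>-nonZero⁻¹ d) (begin
    0      ≡⟨ m<n⇒m%n≡m (>-nonZero⁻¹ n) ⟨
    0 % n  ≡⟨ +-%-cancelˡ k {0} {d} (begin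
      (k + 0) % n  ≡⟨ cong (_% n) (+-identityʳ k) ⟩
      k % n        ≡⟨ proj₂ (edge-injective {l} {l} {k} {d + k} eq) ⟩
      (d + k) % n  ≡⟨ cong (_% n) (+-comm d k) ⟩
      (k + d) % n  ∎) ⟩
    d % n  ≡⟨ m<n⇒m%n≡m d<n ⟩
    d      ∎)
    where open ≡-Reasoning

  residue : ∀ d (i : Fin n) → ∃[ k ] (d + k) mod n ≡ i
  residue d i with residue-in-window n d (toℕ i)
  ... | k , _ , eq = k ,
    trans (mod-cong {d + k} {toℕ i} (trans (cong (_% n) (+-comm d k)) eq)) (toℕ-mod-inverse i)

  module _ (n≥9 : n ≥ 9) (N : EdgeSet) where

    1<n : 1 < n
    1<n = ≤-trans (m≤n+m 2 7) n≥9
    2<n : 2 < n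
    2<n = ≤-trans (m≤n+m 3 6) n≥9

    -- Defined for any edge set, so that `at-u` and `at-v` serve both to read a configuration off a
    -- matching and to certify a matching.
    has′ : Fin 3 → ℕ → Bool
    has′ l k = lookup N (edge (l , k))

    at-u : ∀ k → (∃! _≡_ λ e → e ∈ N × Incident (P n) e (u ((2 + k) mod n))) ⇔
      One (has′ 0F k) (has′ 0F (2 + k)) (has′ 1F (2 + k))
    at-u k = ∃!⇔One N (shift-≢ 0F 2 k 2<n)
      (label-≢ {0F} {1F} {k} {2 + k} λ ()) (label-≢ {0F} {1F} {2 + k} {2 + k} λ ())
      (edges-at-u k)
      (incident⁺ 0F k (inj₂ refl)) (incident⁺ 0F (2 + k) (inj₁ refl)) (incident⁺ 1F (2 + k) (inj₁ refl))

    at-v : ∀ k → (∃! _≡_ λ e → e ∈ N × Incident (P n) e (v ((1 + k) mod n))) ⇔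
      One (has′ 2F k) (has′ 2F (1 + k)) (has′ 1F (1 + k))
    at-v k = ∃!⇔One N (shift-≢ 2F 1 k 1<n)
      (label-≢ {2F} {1F} {k} {1 + k} λ ()) (label-≢ {2F} {1F} {1 + k} {1 + k} λ ())
      (edges-at-v k)
      (incident⁺ 2F k (inj₂ refl)) (incident⁺ 2F (1 + k) (inj₁ refl)) (incident⁺ 1F (1 + k) (inj₂ refl))

    config : IsPerfectMatching (P n) N → Config
    config pm = record
      { has  = has′
      ; oneU = λ k → to (at-u k) (pm (u ((2 + k) mod n)))
      ; oneV = λ k → to (at-v k) (pm (v ((1 + k) mod n)))
      }

    config-periodic : ∀ pm → Periodic n (config pm)
    config-periodic pm l eq = cong (lookup N) (edge-cong l eq)

    matching : (∀ k → One (has′ 0F k) (has′ 0F (2 + k)) (has′ 1F (2 + k))) →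
      (∀ k → One (has′ 2F k) (has′ 2F (1 + k)) (has′ 1F (1 + k))) → IsPerfectMatching (P n) N
    matching oneU oneV (u i) with residue 2 i
    ... | k , refl = from (at-u k) (oneU k)
    matching oneU oneV (v i) with residue 1 i
    ... | k , refl = from (at-v k) (oneV k)

    agree⇒≡ : ∀ {M} → (∀ l k → lookup M (edge (l , k)) ≡ has′ l k) → N ≡ M
    agree⇒≡ {M} agree = subset-ext λ e → pointwise e (edge-surjective e)
      where
      pointwise : ∀ e → (∃[ l ] ∃[ k ] k < n × e ≡ edge (l , k)) → lookup N e ≡ lookup M e
      pointwise _ (l , k , _ , refl) = sym (agree l k)

  -- Upper bound for both types of matchings

  module _ (n≥9 : n ≥ 9) where

    -- Congruent labels name the same edge, so the length of the list bounds the size of the set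
    -- from above, which suffices.
    forcible⇒forcing-set : ∀ M (pm : IsPerfectMatching (P n) M) → Forcible n (config n≥9 M pm) →
      ∃[ S ] IsForcingSet (P n) M S × ∣ S ∣ ≤ ⌈ n /4⌉
    forcible⇒forcing-set M pm (L , L⊆M , size , force) =
      fromList edge L ,
      (fromList-⊆ edge (All.map (lookup⇒[]= _ M) L⊆M) ,
       λ M′ pm′ S⊆M′ → agree⇒≡ n≥9 M′
         (force (config n≥9 M′ pm′) (config-periodic n≥9 M′ pm′)
           (All.map []=⇒lookup (⊆-fromList edge L S⊆M′)))) ,
      ≤-trans (∣fromList∣≤ edge L) (begin
        length L          ≡⟨ m*n/n≡m (length L) 4 ⟨
        length L * 4 / 4  ≤⟨ /-monoˡ-≤ 4 (subst₂ _≤_ (*-comm 4 (length L)) (+-comm 3 n) size) ⟩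
        (n + 3) / 4       ∎)
      where open ≤-Reasoning

    spoked-forcing-set : ∀ M → IsPerfectMatching (P n) M → SpokedType n M →
      ∃[ S ] IsForcingSet (P n) M S × ∣ S ∣ ≤ ⌈ n /4⌉
    spoked-forcing-set M pm ((k , sk) , gaps) =
      forcible⇒forcing-set M pm
        (forcible-spoked n {C} k n≥9 (config-periodic n≥9 M pm) ([]=⇒lookup sk) gaps′)
      where
      open ≤-Reasoning
      C : Config
      C = config n≥9 M pm
      between : ∀ {i g} → (∀ k → k < g → S C (1 + k + i) ≡ false) →
        ∀ k → i < k → k < 1 + g + i → spoke n k ∉ M
      between {i} {g} below k i<k k<j =
        subst (λ k → spoke n k ∉ M) (trans (sym (+-suc (k ∸ suc i) i)) (m∸n+n≡m i<k))
          (lookup⇒∉ (below (k ∸ suc i) (+-cancelʳ-< (suc i) (k ∸ suc i) g (begin-strict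
            k ∸ suc i + suc i  ≡⟨ m∸n+n≡m i<k ⟩
            k                  <⟨ k<j ⟩
            suc g + i          ≡⟨ +-suc g i ⟨
            g + suc i          ∎))))
      gaps′ : GapsDivisibleBy4 n C
      gaps′ i g g<n si sj below = subst (4 ∣_) (cong (_∸ 1) (m+n∸n≡m (1 + g) i))
        (gaps i (1 + g + i)
          ((s≤s (m≤n+m i g) , ≤-trans (+-monoˡ-≤ i g<n) (≤-reflexive (+-comm n i))) ,
           (lookup⇒[]= _ M si , lookup⇒[]= _ M sj) ,
           between below))

    first-quad : ∀ i q → n / 4 ≡ suc q → let M = spokelessMatching n i in
      uu n (i + 0) ∈ M × uu n (i + 0 + 1) ∈ M × vv n (i + 0) ∈ M
    first-quad i q n/4≡ = in-block (x∈p∪q⁺ (inj₁ (x∈⁅x⁆ _))) ,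
      in-block (x∈p∪q⁺ (inj₂ (x∈p∪q⁺ (inj₁ (x∈⁅x⁆ _))))) ,
      in-block (x∈p∪q⁺ (inj₂ (x∈p∪q⁺ (inj₂ (x∈p∪q⁺ (inj₁ (x∈⁅x⁆ _)))))))
      where
      in-block : ∀ {x} →
        x ∈ ⁅ uu n (i + 0) ⁆ ∪ ⁅ uu n (i + 0 + 1) ⁆ ∪ ⁅ vv n (i + 0) ⁆ ∪ ⁅ vv n (i + 0 + 2) ⁆ →
        x ∈ spokelessMatching n i
      in-block x∈ = first∈⋃ n/4≡ x∈

    spokeless-forcing-set : ∀ M → IsPerfectMatching (P n) M → SpokelessType n M →
      ∃[ S ] IsForcingSet (P n) M S × ∣ S ∣ ≤ ⌈ n /4⌉
    spokeless-forcing-set M pm (_ , divides 0 n≡ , _) with () ← subst (9 ≤_) n≡ n≥9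
    spokeless-forcing-set M pm (_ , divides 1 n≡ , _)
      with s≤s (s≤s (s≤s (s≤s ()))) ← subst (9 ≤_) n≡ n≥9
    spokeless-forcing-set M pm (_ , divides 2 n≡ , _)
      with s≤s (s≤s (s≤s (s≤s (s≤s (s≤s (s≤s (s≤s ()))))))) ← subst (9 ≤_) n≡ n≥9
    spokeless-forcing-set M pm (no-spoke , divides (suc (suc (suc q))) n≡ , i , refl) =
      forcible⇒forcing-set M pm
        (forcible-spokeless n {C} {a} (q * 4) n≡ per (λ k → ∉⇒lookup (no-spoke k)) cut)
      where
      C : Config
      C = config n≥9 M pm
      per : Periodic n C
      per = config-periodic n≥9 M pm
      a : ℕ
      -- Chosen so that `2 + a = n + i`: the block at `i` follows the cut at `a`, and the added turn
      -- avoids `i - 2`.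
      a = 10 + q * 4 + i
      uuv : uu n (i + 0) ∈ M × uu n (i + 0 + 1) ∈ M × vv n (i + 0) ∈ M
      uuv = first-quad i (2 + q) (trans (cong (_/ 4) n≡) (m*n/n≡m (3 + q) 4))
      2+a≡ : (2 + a) % n ≡ (i + 0) % n
      2+a≡ = trans (cong (λ m → (m + i) % n) (sym n≡))
               (trans ([n+k]%n n i) (cong (_% n) (sym (+-identityʳ i))))
      u₀ : U C (2 + a) ≡ true
      u₀ = trans (per 0F 2+a≡) ([]=⇒lookup (proj₁ uuv))
      u₁ : U C (3 + a) ≡ true
      u₁ = trans (per 0F (trans (+-%-congˡ 1 {2 + a} {i + 0} 2+a≡) (cong (_% n) (+-comm 1 (i + 0)))))
             ([]=⇒lookup (proj₁ (proj₂ uuv)))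
      v₀ : V C (2 + a) ≡ true
      v₀ = trans (per 2F 2+a≡) ([]=⇒lookup (proj₂ (proj₂ uuv)))
      local : ∀ {x y z} → y ≡ true → One x y z → x ≡ false
      local refl one₂ = refl
      cut : Cut C a
      -- The block matches `u_i`, `u_{i+1}` and `v_i` forward, which excludes the edges reaching
      -- them from behind.
      cut = local v₀ (oneV C (1 + a)) , local u₀ (oneU C a) , local u₁ (oneU C (1 + a))

    forcing-set : ∀ M → 𝓜₁ n M → ∃[ S ] IsForcingSet (P n) M S × ∣ S ∣ ≤ ⌈ n /4⌉
    forcing-set M (pm , inj₁ spoked)    = spoked-forcing-set M pm spoked
    forcing-set M (pm , inj₂ spokeless) = spokeless-forcing-set M pm spokeless

-- The matching of all spokes

bit : Bool → ℕ
bit true  = 1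
bit false = 0

count : (ℕ → Bool) → ℕ → ℕ
count f zero    = 0
count f (suc n) = bit (f 0) + count (f ∘ suc) n

count-∷ʳ : ∀ f n → count f (suc n) ≡ count f n + bit (f n)
count-∷ʳ f zero    = +-identityʳ (bit (f 0))
count-∷ʳ f (suc n) = trans (cong (bit (f 0) +_) (count-∷ʳ (f ∘ suc) n))
  (sym (+-assoc (bit (f 0)) (count (f ∘ suc) n) (bit (f (suc n)))))

-- Both sides complete to `count f (suc n)` by adding the same bit, at the end or at the front.
count-shift : ∀ f n → f n ≡ f 0 → count (f ∘ suc) n ≡ count f n
count-shift f n eq = +-cancelˡ-≡ (bit (f 0)) _ _ (begin
  count f (suc n)          ≡⟨ count-∷ʳ f n ⟩
  count f n + bit (f n)    ≡⟨ cong (λ b → count f n + bit b) eq ⟩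
  count f n + bit (f 0)    ≡⟨ +-comm (count f n) (bit (f 0)) ⟩
  bit (f 0) + count f n    ∎)
  where open ≡-Reasoning

-- Double counting: summed over all windows, each of the four offsets contributes one shifted count.
fourfold-count : ∀ f n →
  (∀ k → k < n → 1 ≤ bit (f k) + bit (f (1 + k)) + bit (f (2 + k)) + bit (f (3 + k))) →
  n ≤ count f n + count (f ∘ suc) n + count (f ∘ (2 +_)) n + count (f ∘ (3 +_)) n
fourfold-count f zero    hit = z≤n
fourfold-count f (suc n) hit = begin
  suc n
    ≤⟨ +-mono-≤ (hit 0 (s≤s z≤n)) (fourfold-count (f ∘ suc) n (λ k k<n → hit (suc k) (s≤s k<n))) ⟩
  bit (f 0) + bit (f 1) + bit (f 2) + bit (f 3) + (c 1 + c 2 + c 3 + c 4)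
    ≡⟨ interleave (bit (f 0)) (bit (f 1)) (bit (f 2)) (bit (f 3)) (c 1) (c 2) (c 3) (c 4) ⟩
  count f (suc n) + count (f ∘ suc) (suc n) + count (f ∘ (2 +_)) (suc n) + count (f ∘ (3 +_)) (suc n)
    ∎
  where
  open ≤-Reasoning
  c : ℕ → ℕ
  c d = count (f ∘ (d +_)) n
  interleave : ∀ a b c d p q r s → a + b + c + d + (p + q + r + s) ≡ a + p + (b + q) + (c + r) + (d + s)
  interleave = solve 8 (λ a b c d p q r s →
    a :+ b :+ c :+ d :+ (p :+ q :+ r :+ s) := a :+ p :+ (b :+ q) :+ (c :+ r) :+ (d :+ s)) refl
    where open +-*-Solver

∣tabulate∣ : ∀ n (f : ℕ → Bool) → ∣ tabulate {n = n} (f ∘ toℕ) ∣ ≡ count f n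
∣tabulate∣ zero    f = refl
∣tabulate∣ (suc n) f with f 0
... | true  = cong suc (∣tabulate∣ n (f ∘ suc))
... | false = ∣tabulate∣ n (f ∘ suc)

-- The edge codes form three blocks of length `n` with the spokes in the middle. Dropping a block
-- and then taking one (`∣take∣≤`) bounds the number of spokes in a set by its size.
∣drop∣≤ : ∀ n {m} (p : Subset (n + m)) → ∣ tabulate (λ i → lookup p (n ↑ʳ i)) ∣ ≤ ∣ p ∣
∣drop∣≤ zero    p       = ≤-reflexive (cong ∣_∣ (tabulate∘lookup p))
∣drop∣≤ (suc n) (x ∷ p) = ≤-trans (∣drop∣≤ n p) (∣p∣≤∣x∷p∣ x p)

∣take∣≤ : ∀ n {m} (p : Subset (n + m)) → ∣ tabulate (λ i → lookup p (i ↑ˡ m)) ∣ ≤ ∣ p ∣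
∣take∣≤ zero    p           = z≤n
∣take∣≤ (suc n) (true  ∷ p) = s≤s (∣take∣≤ n p)
∣take∣≤ (suc n) (false ∷ p) = ∣take∣≤ n p

-- All spokes, except for a 4-tile at position 0.
pattern₀ : Fin 3 → ℕ → Bool
pattern₀ 0F 0 = true
pattern₀ 0F 1 = true
pattern₀ 0F _ = false
pattern₀ 1F 0 = false
pattern₀ 1F 1 = false
pattern₀ 1F 2 = false
pattern₀ 1F 3 = false
pattern₀ 1F _ = true
pattern₀ 2F 0 = true
pattern₀ 2F 2 = true
pattern₀ 2F _ = false

One-cong : ∀ {x y z x′ y′ z′} → x ≡ x′ → y ≡ y′ → z ≡ z′ → One x′ y′ z′ → One x y z
One-cong refl refl refl one = one

-- Exchanging four spokes for a 4-tile

module _ (n : ℕ) .{{_ : NonZero n}} (n≥9 : n ≥ 9) where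

  open Graph (P n) using (EdgeSet)

  fill : (Fin 3 → ℕ → Bool) → EdgeSet
  fill g = tabulate λ e → let (l , i) = remQuot {3} n e in g l (toℕ i)

  lookup-fill : ∀ g l k → lookup (fill g) (edge n (l , k)) ≡ g l (k % n)
  lookup-fill g l k = trans (lookup∘tabulate _ (edge n (l , k)))
    (trans (cong (λ (l , i) → g l (toℕ i)) (remQuot-edge n l k)) (cong (g l) (toℕ-mod n k)))

  -- Away from the seam this is a finite check. At `r = n - 1` the next position is 0, where the
  -- 4-tile starts, and `n ≥ 9` puts `r` outside the tile.
  pattern₀-v : ∀ r → r < n → One (pattern₀ 2F r) (pattern₀ 2F ((1 + r) % n)) (pattern₀ 1F ((1 + r) % n))
  pattern₀-v r r<n with m≤n⇒m<n∨m≡n r<n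
  ... | inj₁ 1+r<n rewrite m<n⇒m%n≡m 1+r<n = go r
    where
    go : ∀ r → One (pattern₀ 2F r) (pattern₀ 2F (1 + r)) (pattern₀ 1F (1 + r))
    go 0 = one₁
    go 1 = one₂
    go 2 = one₁
    go 3 = one₃
    go (suc (suc (suc (suc _)))) = one₃
  ... | inj₂ 1+r≡n rewrite trans (cong (_% n) 1+r≡n) (n%n≡0 n) = far r (subst (9 ≤_) (sym 1+r≡n) n≥9)
    where
    far : ∀ r → 9 ≤ 1 + r → One (pattern₀ 2F r) true false
    far 1 (s≤s (s≤s ()))
    far 2 (s≤s (s≤s (s≤s ())))
    far (suc (suc (suc _))) _ = one₂

  -- Here two residues cross the seam: `n - 1` leads to 1 and `n - 2` leads to 0.
  pattern₀-u : ∀ r → r < n → One (pattern₀ 0F r) (pattern₀ 0F ((2 + r) % n)) (pattern₀ 1F ((2 + r) % n))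
  pattern₀-u r r<n with m≤n⇒m<n∨m≡n r<n
  ... | inj₂ 1+r≡n rewrite trans (cong (λ m → suc m % n) 1+r≡n)
                            (trans ([m+n]%n≡m%n 1 n) (m<n⇒m%n≡m (≤-trans (m≤n+m 2 7) n≥9))) =
    far r (subst (9 ≤_) (sym 1+r≡n) n≥9)
    where
    far : ∀ r → 9 ≤ 1 + r → One (pattern₀ 0F r) true false
    far 1 (s≤s (s≤s ()))
    far (suc (suc _)) _ = one₂
  ... | inj₁ 1+r<n with m≤n⇒m<n∨m≡n 1+r<n
  ...   | inj₂ 2+r≡n rewrite trans (cong (_% n) 2+r≡n) (n%n≡0 n) = far r (subst (9 ≤_) (sym 2+r≡n) n≥9)
    where
    far : ∀ r → 9 ≤ 2 + r → One (pattern₀ 0F r) true false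
    far 0 (s≤s (s≤s ()))
    far 1 (s≤s (s≤s (s≤s ())))
    far (suc (suc _)) _ = one₂
  ...   | inj₁ 2+r<n rewrite m<n⇒m%n≡m 2+r<n = go r
    where
    go : ∀ r → One (pattern₀ 0F r) (pattern₀ 0F (2 + r)) (pattern₀ 1F (2 + r))
    go 0 = one₁
    go 1 = one₁
    go (suc (suc _)) = one₃

  isSpoke : Fin 3 → ℕ → Bool
  isSpoke 1F _ = true
  isSpoke _  _ = false

  spokes : EdgeSet
  spokes = fill isSpoke

  spokes-matching : IsPerfectMatching (P n) spokes
  spokes-matching = matching n n≥9 spokes
    (λ k → One-cong (look 0F k) (look 0F (2 + k)) (look 1F (2 + k)) one₃)
    (λ k → One-cong (look 2F k) (look 2F (1 + k)) (look 1F (1 + k)) one₃)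
    where
    look : ∀ l k → lookup spokes (edge n (l , k)) ≡ isSpoke l (k % n)
    look = lookup-fill isSpoke

  spokes-spoked : SpokedType n spokes
  spokes-spoked = (0 , spoke∈ 0) , gap
    where
    spoke∈ : ∀ k → spoke n k ∈ spokes
    spoke∈ k = lookup⇒[]= _ spokes (lookup-fill isSpoke 1F k)
    gap : ∀ i j → ConsecutiveSpokes n spokes i j → 4 ∣ j ∸ i ∸ 1
    gap i j ((i<j , _) , _ , between) with m≤n⇒m<n∨m≡n i<j
    ... | inj₁ 1+i<j = ⊥-elim (between (1 + i) ≤-refl 1+i<j (spoke∈ (1 + i)))
    ... | inj₂ refl  = divides 0 (cong (_∸ 1) (m+n∸n≡m 1 i))

  module _ (w : ℕ) (w<n : w < n) where

    -- Since `n ∸ w` represents `- w`, the 4-tile moves from position 0 to `w`.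
    flipped : EdgeSet
    flipped = fill λ l k → pattern₀ l ((n ∸ w + k) % n)

    lookup-flipped : ∀ l k → lookup flipped (edge n (l , k)) ≡ pattern₀ l ((n ∸ w + k) % n)
    lookup-flipped l k = trans (lookup-fill (λ l k → pattern₀ l ((n ∸ w + k) % n)) l k)
      (cong (pattern₀ l) (%-+ʳ n (n ∸ w) k))

    lookup-flipped-+ : ∀ l d k →
      lookup flipped (edge n (l , d + k)) ≡ pattern₀ l ((d + (n ∸ w + k) % n) % n)
    lookup-flipped-+ l d k = trans (lookup-flipped l (d + k)) (cong (pattern₀ l) (begin
      (n ∸ w + (d + k)) % n      ≡⟨ cong (_% n) (x∙yz≈y∙xz (n ∸ w) d k) ⟩
      (d + (n ∸ w + k)) % n      ≡⟨ %-+ʳ n d (n ∸ w + k) ⟨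
      (d + (n ∸ w + k) % n) % n  ∎))
      where open ≡-Reasoning

    flipped-matching : IsPerfectMatching (P n) flipped
    flipped-matching = matching n n≥9 flipped
      (λ k → One-cong (lookup-flipped 0F k) (lookup-flipped-+ 0F 2 k) (lookup-flipped-+ 1F 2 k)
               (pattern₀-u _ (m%n<n _ n)))
      (λ k → One-cong (lookup-flipped 2F k) (lookup-flipped-+ 2F 1 k) (lookup-flipped-+ 1F 1 k)
               (pattern₀-v _ (m%n<n _ n)))

    flipped≢spokes : flipped ≢ spokes
    flipped≢spokes eq = clash (trans (cong (λ N → lookup N (edge n (1F , w))) eq) (lookup-fill isSpoke 1F w))
      (trans (lookup-flipped 1F w)
        (cong (pattern₀ 1F) (trans (cong (_% n) (m∸n+n≡m (<⇒≤ w<n))) (n%n≡0 n))))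

    spoke-index : ∀ k → ((n ∸ w + k) % n + w) % n ≡ k % n
    spoke-index k = begin
      ((n ∸ w + k) % n + w) % n  ≡⟨ cong (_% n) (+-comm _ w) ⟩
      (w + (n ∸ w + k) % n) % n  ≡⟨ %-+ʳ n w (n ∸ w + k) ⟩
      (w + (n ∸ w + k)) % n      ≡⟨ cong (_% n) (+-assoc w (n ∸ w) k) ⟨
      (w + (n ∸ w) + k) % n      ≡⟨ cong (λ m → (m + k) % n) (m+[n∸m]≡n (<⇒≤ w<n)) ⟩
      (n + k) % n                ≡⟨ [n+k]%n n k ⟩
      k % n                      ∎
      where open ≡-Reasoning

    -- The only spokes that the exchange removes are those at `w`, ..., `w + 3` modulo `n`.
    ⊆-flipped : ∀ {S} → S ⊆ spokes →
      (∀ j → j < 4 → lookup S (edge n (1F , j + w)) ≡ false) → S ⊆ flipped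
    ⊆-flipped {S} S⊆ miss {x} x∈S with edge-surjective n x
    ... | 0F , k , _ , refl = ⊥-elim (lookup⇒∉ (lookup-fill isSpoke 0F k) (S⊆ x∈S))
    ... | 2F , k , _ , refl = ⊥-elim (lookup⇒∉ (lookup-fill isSpoke 2F k) (S⊆ x∈S))
    ... | 1F , k , _ , refl = lookup⇒[]= _ flipped (trans (lookup-flipped 1F k) (go _ refl))
      where
      near : ∀ r → r < 4 → (n ∸ w + k) % n ≡ r → ⊥
      near r r<4 eq = lookup⇒∉ (miss r r<4)
        (subst (_∈ S) (edge-cong n 1F (trans (sym (spoke-index k)) (cong (λ r → (r + w) % n) eq))) x∈S)
      go : ∀ r → (n ∸ w + k) % n ≡ r → pattern₀ 1F r ≡ true
      go 0 eq = ⊥-elim (near 0 (s≤s z≤n) eq)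
      go 1 eq = ⊥-elim (near 1 (s≤s (s≤s z≤n)) eq)
      go 2 eq = ⊥-elim (near 2 (s≤s (s≤s (s≤s z≤n))) eq)
      go 3 eq = ⊥-elim (near 3 (s≤s (s≤s (s≤s (s≤s z≤n)))) eq)
      go (suc (suc (suc (suc _)))) _ = refl

  module _ {S} (forcing : IsForcingSet (P n) spokes S) where

    h : ℕ → Bool
    h k = lookup S (edge n (1F , k))

    -- If `S` missed the window, the matching `flipped` would contain `S` and differ from `spokes`.
    window-hit : ∀ w → w < n → 1 ≤ bit (h w) + bit (h (1 + w)) + bit (h (2 + w)) + bit (h (3 + w))
    window-hit w w<n with h w in h₀ | h (1 + w) in h₁ | h (2 + w) in h₂ | h (3 + w) in h₃
    ... | true  | _     | _     | _     = s≤s z≤n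
    ... | false | true  | _     | _     = s≤s z≤n
    ... | false | false | true  | _     = s≤s z≤n
    ... | false | false | false | true  = s≤s z≤n
    ... | false | false | false | false = ⊥-elim (flipped≢spokes w w<n
      (proj₂ forcing (flipped w w<n) (flipped-matching w w<n) (⊆-flipped w w<n (proj₁ forcing) miss)))
      where
      miss : ∀ j → j < 4 → h (j + w) ≡ false
      miss 0 _ = h₀
      miss 1 _ = h₁
      miss 2 _ = h₂
      miss 3 _ = h₃
      miss (suc (suc (suc (suc _)))) (s≤s (s≤s (s≤s (s≤s ()))))

    h-periodic : ∀ k → h (k + n) ≡ h k
    h-periodic k = cong (lookup S) (edge-cong n 1F ([m+n]%n≡m%n k n))

    count-h-shift : ∀ d → count (h ∘ (d +_)) n ≡ count h n
    count-h-shift zero    = refl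
    count-h-shift (suc d) = trans (count-cong n λ k → cong h (sym (+-suc d k)))
      (trans (count-shift (h ∘ (d +_)) n (trans (h-periodic d) (cong h (sym (+-identityʳ d)))))
             (count-h-shift d))
      where
      count-cong : ∀ n {f g : ℕ → Bool} → (∀ k → f k ≡ g k) → count f n ≡ count g n
      count-cong zero    eq = refl
      count-cong (suc n) eq = cong₂ _+_ (cong bit (eq 0)) (count-cong n (eq ∘ suc))

    count-h≤ : count h n ≤ ∣ S ∣
    count-h≤ = begin
      count h n                       ≡⟨ ∣tabulate∣ n h ⟨
      ∣ tabulate {n = n} (h ∘ toℕ) ∣  ≡⟨ cong ∣_∣ (tabulate-cong same) ⟩
      ∣ tabulate {n = n} (λ i → lookup tail (i ↑ˡ (n + 0))) ∣  ≤⟨ ∣take∣≤ n tail ⟩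
      ∣ tail ∣                        ≤⟨ ∣drop∣≤ n S ⟩
      ∣ S ∣                           ∎
      where
      open ≤-Reasoning
      tail : Subset (n + (n + 0))
      tail = tabulate (λ j → lookup S (n ↑ʳ j))
      same : ∀ i → h (toℕ i) ≡ lookup tail (i ↑ˡ (n + 0))
      same i = trans (cong (λ i → lookup S (combine {3} 1F i)) (toℕ-mod-inverse n i))
                 (sym (lookup∘tabulate (λ j → lookup S (n ↑ʳ j)) (i ↑ˡ (n + 0))))

    ⌈n/4⌉≤∣S∣ : ⌈ n /4⌉ ≤ ∣ S ∣
    -- The quotient is below `suc ∣ S ∣` because `n + 3 < n + 4` and `n` is at most four times the
    -- count.
    ⌈n/4⌉≤∣S∣ = s≤s⁻¹ (m<n*o⇒m/o<n {n + 3} {suc ∣ S ∣} {4} (begin-strict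
      n + 3 <⟨ +-monoʳ-< n (n<1+n 3) ⟩
      n + 4 ≤⟨ +-monoˡ-≤ 4 (fourfold-count h n window-hit) ⟩
      count h n + count (h ∘ suc) n + count (h ∘ (2 +_)) n + count (h ∘ (3 +_)) n + 4
        ≡⟨ cong (_+ 4) (cong₂ _+_ (cong₂ _+_ (cong (count h n +_)
             (count-h-shift 1)) (count-h-shift 2)) (count-h-shift 3)) ⟩
      count h n + count h n + count h n + count h n + 4 ≡⟨ collect (count h n) ⟩
      suc (count h n) * 4 ≤⟨ *-monoˡ-≤ 4 (s≤s count-h≤) ⟩
      suc ∣ S ∣ * 4 ∎))
      where
      open ≤-Reasoning
      collect : ∀ c → c + c + c + c + 4 ≡ suc c * 4
      collect = solve 1 (λ c → c :+ c :+ c :+ c :+ con 4 := (con 1 :+ c) :* con 4) refl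
        where open +-*-Solver

  spokes-𝓜₁ : 𝓜₁ n spokes
  spokes-𝓜₁ = spokes-matching , inj₁ spokes-spoked

  forcing-number-spokes : IsForcingNumber (P n) spokes ⌈ n /4⌉
  forcing-number-spokes =
    let S , forcing , ∣S∣≤ = forcing-set n n≥9 spokes spokes-𝓜₁ in
    (S , forcing , ≤-antisym ∣S∣≤ (⌈n/4⌉≤∣S∣ forcing)) ,
    λ m (S′ , forcing′ , ∣S′∣≡m) → subst (⌈ n /4⌉ ≤_) ∣S′∣≡m (⌈n/4⌉≤∣S∣ forcing′)

theorem3p1 : (n : ℕ) .{{_ : NonZero n}} → n ≥ 9 →
    IsMaximum (λ m → ∃[ M ] 𝓜₁ n M × IsForcingNumber (P n) M m) ⌈ n /4⌉
theorem3p1 n n≥9 =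
  (spokes n n≥9 , spokes-𝓜₁ n n≥9 , forcing-number-spokes n n≥9) ,
  λ m (M , M∈𝓜₁ , _ , minimal) →
    let S , forcing , ∣S∣≤ = forcing-set n n≥9 M M∈𝓜₁ in
    ≤-trans (minimal ∣ S ∣ (S , forcing , refl)) ∣S∣≤
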